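{- For integers $b\ge 0$ and $n\ge1$, let $ss_b(n)$ be the number of multiplex siteswap patterns of period $n$ using exactly $b$ balls. Then \[ ss_b(n)=\operatorname{tr}(A_b^n)-\sum_{i=0}^{b-1}\operatorname{tr}(A_i^n). \]
   Context: A multiplex siteswap pattern of period $n$ is a sequence $(T_0,\ldots,T_{n-1})$ of finite multisets of positive integers (throw heights; $T_t$ may be empty) such that for every $t\in\{0,\ldots,n-1\}$, $|T_t|$ equals the number of pairs $(s,h)$, counted with multiplicity, with $s\in\{0,\ldots,n-1\}$, $h\in T_s$ and $s+h\equiv t\pmod n$ (balls caught at time $t$ equal balls thrown at time $t$ when the sequence is repeated periodically). The number of balls of such a pattern is $\frac1n\sum_{s=0}^{n-1}\sum_{h\in T_s}h$. Sequences are counted as sequences (not up to rotation), and need not have minimal period $n$. An ordered partition (composition) of a positive integer $b$ is a finite sequence $(q_1,\ldots,q_k)$ of positive integers with sum $b$. For ordered partitions $q=(q_1,\ldots,q_k)$, $r=(r_1,\ldots,r_\ell)$ of $b$, a nontrivial embedding of $q$ into $r$ is a choice of indices $1\le i_2<\cdots<i_k\le\ell$ with $q_j\le r_{i_j}$ for $2\le j\le k$ (when $k=1$ there is exactly one, the empty choice). For $b\ge1$, $A_b$ is the matrix indexed by ordered partitions of $b$ whose $(q,r)$ entry is the number of nontrivial embeddings of $q$ into $r$ plus $1$ if $q=r$. By convention $A_0=(1)$. -}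

module Defs where

open import Data.Nat using (ℕ; zero; suc; _+_; _*_; _≤_; _≤?_; NonZero)
open import Data.Nat.Properties using (_≟_)
open import Data.Nat.DivMod using (_%_)
open import Data.Nat.ListAction using (sum)
open import Data.Integer as ℤ using (ℤ; +_; _-_)
open import Data.Fin using (Fin; toℕ; _≟_)
open import Data.List using (List; []; _∷_; [_]; _++_; map; concatMap; length; filter; allFin; upTo; drop)
open import Data.List.Relation.Unary.All using (All)
open import Data.List.Relation.Unary.Linked using (Linked)
open import Data.Vec using (Vec; lookup; toList)
import Data.Vec.Relation.Unary.All as VAll
open import Data.Product using (_×_)
open import Relation.Binary.PropositionalEquality using (_≡_)
open import Relation.Nullary using (does)
open import Data.Bool using (if_then_else_)
import Data.List.Properties as LP

-- Multiplex siteswaps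
-- A finite multiset of positive integers is represented canonically as a
-- nondecreasingly sorted list of positive naturals.

IsMultiset⁺ : List ℕ → Set
IsMultiset⁺ S = Linked _≤_ S × All (1 ≤_) S

catches : (n : ℕ) .{{_ : NonZero n}} → Vec (List ℕ) n → Fin n → ℕ
catches n T t =
  sum (map (λ s → length (filter (λ h → ((toℕ s + h) % n) Data.Nat.Properties.≟ toℕ t) (lookup T s)))
           (allFin n))

totalHeight : {n : ℕ} → Vec (List ℕ) n → ℕ
totalHeight T = sum (map sum (toList T))

-- T is a multiplex siteswap pattern of period n with exactly b balls
-- (number of balls = (1/n)·totalHeight, stated as totalHeight = n·b)
IsMultiplexSiteswap : (n : ℕ) .{{_ : NonZero n}} → ℕ → Vec (List ℕ) n → Set
IsMultiplexSiteswap n b T =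
  VAll.All IsMultiset⁺ T
  × (∀ (t : Fin n) → length (lookup T t) ≡ catches n T t)
  × totalHeight T ≡ n * b

-- Ordered partitions (compositions) of b, enumerated without repetition.
-- Each composition of b+1 is either 1 ∷ c or (q+1) ∷ r with c, q ∷ r
-- compositions of b.

compositions : ℕ → List (List ℕ)
compositions zero = [ [] ]
compositions (suc b) = map (1 ∷_) (compositions b) ++ concatMap incHead (compositions b)
  where
  incHead : List ℕ → List (List ℕ)
  incHead [] = []
  incHead (q ∷ r) = [ suc q ∷ r ]

-- number of index choices i₁ < ⋯ < i_k (into ys) with xs_j ≤ ys_{i_j}
embeddings : List ℕ → List ℕ → ℕ
embeddings [] ys = 1
embeddings (x ∷ xs) [] = 0
embeddings (x ∷ xs) (y ∷ ys) =
  (if does (x ≤? y) then embeddings xs ys else 0) + embeddings (x ∷ xs) ys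

-- number of nontrivial embeddings of q into r: choices for q₂,…,q_k
nontrivialEmbeddings : List ℕ → List ℕ → ℕ
nontrivialEmbeddings q r = embeddings (drop 1 q) r

Matrix : ℕ → Set
Matrix m = Fin m → Fin m → ℕ

identity : (m : ℕ) → Matrix m
identity m i j = if does (i Data.Fin.≟ j) then 1 else 0

_⊗_ : {m : ℕ} → Matrix m → Matrix m → Matrix m
_⊗_ {m} M N i j = sum (map (λ k → M i k * N k j) (allFin m))

_^ᴹ_ : {m : ℕ} → Matrix m → ℕ → Matrix m
_^ᴹ_ {m} M zero = identity m
M ^ᴹ suc k = M ⊗ (M ^ᴹ k)

trace : {m : ℕ} → Matrix m → ℕ
trace {m} M = sum (map (λ i → M i i) (allFin m))

dim : ℕ → ℕ
dim b = length (compositions b)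

-- A_b, indexed by compositions of b (in the order of `compositions b`);
-- A_0 = (1) by convention.
A : (b : ℕ) → Matrix (dim b)
A zero i j = 1
A (suc b) i j =
  nontrivialEmbeddings q r + (if does (LP.≡-dec Data.Nat.Properties._≟_ q r) then 1 else 0)
  where
  q = Data.List.lookup (compositions (suc b)) i
  r = Data.List.lookup (compositions (suc b)) j

ssFormula : ℕ → ℕ → ℤ
ssFormula b n = + trace (A b ^ᴹ n) - + sum (map (λ i → trace (A i ^ᴹ n)) (upTo b))

{-# OPTIONS --safe #-}
module Submission where

-- A state of a pattern records how many balls land at each future time.
-- Forgetting the empty times turns a state into an ordered partition and a
-- time step into a card, so a siteswap gives a closed walk in the graph of A_b.
-- Conversely, landing times are transported backwards along a closed walk, and
-- a siteswap with this walk is the same as a fixed point of the transport.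
-- If every card sends the last group to the last group, the transport
-- postpones the last landing and has no fixed point. Otherwise each round
-- lowers the number of groups (counted from the last one) whose landing times
-- are still undetermined, so the fixed point exists and is unique.
-- In a closed walk of the first kind the last group keeps its size, hence
-- deleting it gives an arbitrary closed walk in the graph of A_i for some i < b.

open import Defs
open import Data.Bool using (Bool; true; false; if_then_else_; _∧_)
import Data.Bool.Properties as Bool
open import Data.Fin using (zero; suc; toℕ)
import Data.Fin as Fin
open import Data.Fin.Properties using (toℕ<n)
import Data.Integer as ℤ
import Data.Integer.Properties as ℤ
open import Data.List using (List; []; _∷_; [_]; _++_; _∷ʳ_; map; concatMap; length; filter; upTo; allFin; tabulate; replicate; cartesianProductWith; initLast; _∷ʳ′_)
import Data.List as List
import Data.List.Properties as List
open import Data.List.Membership.Propositional using (_∈_; find; lose)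
open import Data.List.Membership.Propositional.Properties
open import Data.List.Membership.Propositional.Properties.WithK using (unique∧set⇒bag)
open import Data.List.Relation.Binary.BagAndSetEquality using (∼bag⇒↭)
open import Data.List.Relation.Binary.Permutation.Propositional.Properties using (↭-length)
open import Data.List.Relation.Unary.All as All using (All; []; _∷_)
import Data.List.Relation.Unary.All.Properties as All
open import Data.List.Relation.Unary.AllPairs using ([]; _∷_)
open import Data.List.Relation.Unary.Any using (here; there)
open import Data.List.Relation.Unary.Linked as Linked using (Linked; []; [-]; _∷_)
open import Data.List.Relation.Unary.Linked.Properties using (Linked⇒AllPairs)
open import Data.List.Relation.Unary.Unique.Propositional using (Unique)
import Data.List.Relation.Unary.Unique.Propositional.Properties as Unique
open import Data.Maybe using (Maybe; just; nothing)
open import Data.Maybe.Properties using (just-injective)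
open import Data.Nat
open import Data.Nat.DivMod using (_%_; m<n⇒m%n≡m; [m+n]%n≡m%n)
open import Data.Nat.ListAction using (sum)
open import Data.Nat.ListAction.Properties using (sum-++)
open import Data.Nat.Properties
open import Data.Nat.Tactic.RingSolver using (solve-∀)
open import Data.Product using (Σ; _×_; _,_; proj₁; proj₂; ∃; ∃₂)
open import Data.Sum using (_⊎_; inj₁; inj₂)
open import Data.Vec using (Vec; []; _∷_)
import Data.Vec as Vec
import Data.Vec.Properties as Vec
open import Data.Vec.Relation.Unary.All using ([]; _∷_)
import Data.Vec.Relation.Unary.All as VAll
open import Function using (_∘_; case_of_)
open import Function.Bundles using (_⇔_; mk⇔)
open import Relation.Binary.Definitions using (tri<; tri≈; tri>)
open import Relation.Binary.PropositionalEquality hiding ([_])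
open import Relation.Nullary using (¬_; Dec; yes; no; does; ofʸ; ofⁿ; contradiction)
open import Relation.Nullary.Decidable using (¬?)
open import Relation.Unary using (Decidable)

-- Transport runs backwards because only this direction is a function: a throw may create a group at
-- any landing time, so the gaps before a card do not determine the gaps after it, whereas the gaps
-- after it do determine those before. A closed walk thus induces a self-map of the gap lists of its
-- first state. The throws carry no data of their own: they are the difference of consecutive
-- states, nonnegative because an embedding only sends a group to one at least as large. Patterns
-- must also be matched with closed sequences of states. Here `catches` sees landing times modulo
-- `n` only, while a state distinguishes all future times. The state at time 0 collects what earlier
-- periods have thrown beyond that time, and finite supports make these sums finite. The number of
-- balls is recovered from the heights through a first moment. All counts are lengths of lists
-- without repetition. The traces that are subtracted count a sublist of the closed walks, so the
-- difference in ℤ is a natural number.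

-- Lists without repetition and their lengths

module _ {X Y : Set} (f : X → List Y) where

  ∈-concatMap-intro : ∀ {xs x y} → x ∈ xs → y ∈ f x → y ∈ concatMap f xs
  ∈-concatMap-intro x∈ y∈ = ∈-concatMap⁺ f (lose x∈ y∈)

  ∈-concatMap-elim : ∀ xs {y} → y ∈ concatMap f xs → ∃ λ x → x ∈ xs × y ∈ f x
  ∈-concatMap-elim xs y∈ = find (∈-concatMap⁻ f {xs = xs} y∈)

  length-concatMap : ∀ xs → length (concatMap f xs) ≡ sum (map (length ∘ f) xs)
  length-concatMap [] = refl
  length-concatMap (x ∷ xs) =
    trans (List.length-++ (f x)) (cong (length (f x) +_) (length-concatMap xs))

  -- `key` reads off from an element the index of its block, so blocks with distinct indices are
  -- disjoint.
  concatMap-unique : (key : Y → X) → (∀ x {y} → y ∈ f x → key y ≡ x) →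
    (∀ x → Unique (f x)) → ∀ {xs} → Unique xs → Unique (concatMap f xs)
  concatMap-unique key key-f uf [] = []
  concatMap-unique key key-f uf {x ∷ xs} (x∉ ∷ u) =
    Unique.++⁺ (uf x) (concatMap-unique key key-f uf u) λ (y∈ , y∈′) →
      let x′ , x′∈ , y∈x′ = ∈-concatMap-elim xs y∈′
      in All.lookup x∉ x′∈ (trans (sym (key-f x y∈)) (key-f x′ y∈x′))

length-cartesianProductWith : ∀ {X Y Z : Set} (f : X → Y → Z) xs ys →
  length (cartesianProductWith f xs ys) ≡ length xs * length ys
length-cartesianProductWith f [] ys = refl
length-cartesianProductWith f (x ∷ xs) ys =
  trans (List.length-++ (map (f x) ys))
    (cong₂ _+_ (List.length-map (f x) ys) (length-cartesianProductWith f xs ys))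

map-unique : ∀ {X Y : Set} (f : X → Y) {xs} →
  (∀ {x y} → x ∈ xs → y ∈ xs → f x ≡ f y → x ≡ y) → Unique xs → Unique (map f xs)
map-unique f inj [] = []
map-unique f inj (x∉ ∷ u) =
  All.map⁺ (All.tabulate λ y∈ eq → All.lookup x∉ y∈ (inj (here refl) (there y∈) eq))
  ∷ map-unique f (λ x∈ y∈ → inj (there x∈) (there y∈)) u

sum-map-lookup : ∀ {X : Set} (h : X → ℕ) (xs : List X) →
  sum (map (λ k → h (List.lookup xs k)) (allFin (length xs))) ≡ sum (map h xs)
sum-map-lookup h xs = cong sum (begin
  map (h ∘ List.lookup xs) (allFin (length xs))        ≡⟨ List.map-∘ _ ⟩
  map h (map (List.lookup xs) (allFin (length xs)))    ≡⟨ cong (map h) (List.map-tabulate _ (List.lookup xs)) ⟩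
  map h (tabulate (List.lookup xs))                    ≡⟨ cong (map h) (List.tabulate-lookup xs) ⟩
  map h xs                                        ∎)
  where open ≡-Reasoning

lookup-injective : ∀ {X : Set} {xs : List X} → Unique xs → ∀ i j → List.lookup xs i ≡ List.lookup xs j → i ≡ j
lookup-injective (x∉ ∷ u) zero zero eq = refl
lookup-injective {xs = _ ∷ xs} (x∉ ∷ u) zero (suc j) eq = contradiction eq (All.lookup x∉ (∈-lookup {xs = xs} j))
lookup-injective {xs = _ ∷ xs} (x∉ ∷ u) (suc i) zero eq = contradiction (sym eq) (All.lookup x∉ (∈-lookup {xs = xs} i))
lookup-injective (x∉ ∷ u) (suc i) (suc j) eq = cong suc (lookup-injective u i j eq)

-- The enumeration of compositions

Pos : List ℕ → Set
Pos = All (1 ≤_)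

IsComp : ℕ → List ℕ → Set
IsComp b q = Pos q × sum q ≡ b

-- `inc` stands for the local function `incHead` of `compositions`.
module _ (inc : List ℕ → List (List ℕ)) (inc-[] : inc [] ≡ []) (inc-∷ : ∀ q r → inc (q ∷ r) ≡ [ suc q ∷ r ]) where

  private
    decHead : List ℕ → List ℕ
    decHead [] = []
    decHead (q ∷ r) = pred q ∷ r

    ∈-inc : ∀ c {d} → d ∈ inc c → ∃₂ λ q r → c ≡ q ∷ r × d ≡ suc q ∷ r
    ∈-inc [] d∈ rewrite inc-[] = case d∈ of λ ()
    ∈-inc (q ∷ r) d∈ rewrite inc-∷ q r with d∈
    ... | here eq = q , r , refl , eq

  -- The first half starts with 1 and the second with at least 2, parts being positive; `decHead`
  -- undoes `inc` and serves as the key of the second half.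
  extend-unique : ∀ {cs} → All Pos cs → Unique cs → Unique (map (1 ∷_) cs ++ concatMap inc cs)
  extend-unique {cs} pos u =
    Unique.++⁺ (Unique.map⁺ (proj₂ ∘ List.∷-injective) u)
      (concatMap-unique inc decHead key inc-unique u) λ (d∈ , d∈′) → disjoint d∈ d∈′
    where
    key : ∀ c {d} → d ∈ inc c → decHead d ≡ c
    key c d∈ with ∈-inc c d∈
    ... | q , r , refl , refl = refl
    inc-unique : ∀ c → Unique (inc c)
    inc-unique [] rewrite inc-[] = []
    inc-unique (q ∷ r) rewrite inc-∷ q r = [] ∷ []
    disjoint : ∀ {d} → d ∈ map (1 ∷_) cs → ¬ (d ∈ concatMap inc cs)
    disjoint d∈ d∈′ with ∈-map⁻ (1 ∷_) d∈ | ∈-concatMap-elim inc cs d∈′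
    ... | _ , _ , refl | c , c∈ , d∈c with ∈-inc c d∈c
    ... | q , r , refl , refl with All.lookup pos c∈
    ... | () ∷ _

  ∈-extend⁻ : ∀ {b cs} → (∀ {c} → c ∈ cs → IsComp b c) →
    ∀ {d} → d ∈ map (1 ∷_) cs ++ concatMap inc cs → IsComp (suc b) d
  ∈-extend⁻ {cs = cs} h d∈ with ∈-++⁻ (map (1 ∷_) cs) d∈
  ... | inj₁ d∈′ with ∈-map⁻ (1 ∷_) d∈′
  ...   | c , c∈ , refl = s≤s z≤n ∷ proj₁ (h c∈) , cong suc (proj₂ (h c∈))
  ∈-extend⁻ {cs = cs} h d∈ | inj₂ d∈′ with ∈-concatMap-elim inc cs d∈′
  ...   | c , c∈ , d∈c with ∈-inc c d∈c
  ...     | q , r , refl , refl with h c∈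
  ...       | _ ∷ pos , eq = s≤s z≤n ∷ pos , cong suc eq

  ∈-extend⁺ : ∀ {b cs} → (∀ {c} → IsComp b c → c ∈ cs) →
    ∀ {d} → IsComp (suc b) d → d ∈ map (1 ∷_) cs ++ concatMap inc cs
  ∈-extend⁺ h {suc zero ∷ d} (_ ∷ pos , eq) = ∈-++⁺ˡ (∈-map⁺ (1 ∷_) (h (pos , suc-injective eq)))
  ∈-extend⁺ {cs = cs} h {suc (suc q) ∷ d} (_ ∷ pos , eq) =
    ∈-++⁺ʳ (map (1 ∷_) cs) (∈-concatMap-intro inc (h {suc q ∷ d} (s≤s z≤n ∷ pos , suc-injective eq))
      (subst (_ ∈_) (sym (inc-∷ (suc q) d)) (here refl)))

∈-compositions⁻ : ∀ b {q} → q ∈ compositions b → IsComp b q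
∈-compositions⁻ zero (here refl) = [] , refl
∈-compositions⁻ (suc b) = ∈-extend⁻ _ refl (λ _ _ → refl) (∈-compositions⁻ b)

∈-compositions⁺ : ∀ b {q} → IsComp b q → q ∈ compositions b
∈-compositions⁺ zero {[]} _ = here refl
∈-compositions⁺ zero {suc _ ∷ _} (_ , ())
∈-compositions⁺ zero {zero ∷ _} (() ∷ _ , _)
∈-compositions⁺ (suc b) = ∈-extend⁺ _ refl (λ _ _ → refl) (∈-compositions⁺ b)

compositions-unique : ∀ b → Unique (compositions b)
compositions-unique zero = [] ∷ []
compositions-unique (suc b) =
  extend-unique _ refl (λ _ _ → refl) (All.tabulate (proj₁ ∘ ∈-compositions⁻ b)) (compositions-unique b)

-- Embeddings, cards and walks

-- A nontrivial embedding into `ys` is coded by the mask selecting its image.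
data IsEmb : List ℕ → List ℕ → List Bool → Set where
  []   : IsEmb [] [] []
  take : ∀ {x y xs ys bs} → x ≤ y → IsEmb xs ys bs → IsEmb (x ∷ xs) (y ∷ ys) (true ∷ bs)
  skip : ∀ {y xs ys bs} → IsEmb xs ys bs → IsEmb xs (y ∷ ys) (false ∷ bs)

-- A mask has the full length of `ys`, so the empty choice is padded with `false`; here the
-- recursion differs from that of `embeddings`.
embs : List ℕ → List ℕ → List (List Bool)
embs [] [] = [ [] ]
embs [] (y ∷ ys) = map (false ∷_) (embs [] ys)
embs (x ∷ xs) [] = []
embs (x ∷ xs) (y ∷ ys) =
  (if x ≤ᵇ y then map (true ∷_) (embs xs ys) else []) ++ map (false ∷_) (embs (x ∷ xs) ys)

embs-unique : ∀ xs ys → Unique (embs xs ys)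
embs-unique [] [] = [] ∷ []
embs-unique [] (y ∷ ys) = Unique.map⁺ (proj₂ ∘ List.∷-injective) (embs-unique [] ys)
embs-unique (x ∷ xs) [] = []
embs-unique (x ∷ xs) (y ∷ ys) with x ≤ᵇ y | ≤ᵇ-reflects-≤ x y
... | false | _ = Unique.map⁺ (proj₂ ∘ List.∷-injective) (embs-unique (x ∷ xs) ys)
... | true | _ = Unique.++⁺ (Unique.map⁺ (proj₂ ∘ List.∷-injective) (embs-unique xs ys))
    (Unique.map⁺ (proj₂ ∘ List.∷-injective) (embs-unique (x ∷ xs) ys)) λ (p , q) → disjoint p q
  where
  disjoint : ∀ {bs} → bs ∈ map (true ∷_) (embs xs ys) → ¬ (bs ∈ map (false ∷_) (embs (x ∷ xs) ys))
  disjoint p q with ∈-map⁻ (true ∷_) p | ∈-map⁻ (false ∷_) q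
  ... | _ , _ , refl | _ , _ , ()

∈-embs⁻ : ∀ xs ys {bs} → bs ∈ embs xs ys → IsEmb xs ys bs
∈-embs⁻ [] [] (here refl) = []
∈-embs⁻ [] (y ∷ ys) p with ∈-map⁻ (false ∷_) p
... | _ , q , refl = skip (∈-embs⁻ [] ys q)
∈-embs⁻ (x ∷ xs) (y ∷ ys) p with x ≤ᵇ y | ≤ᵇ-reflects-≤ x y
∈-embs⁻ (x ∷ xs) (y ∷ ys) p | false | _ with ∈-map⁻ (false ∷_) p
... | _ , q , refl = skip (∈-embs⁻ (x ∷ xs) ys q)
∈-embs⁻ (x ∷ xs) (y ∷ ys) p | true | ofʸ x≤y with ∈-++⁻ (map (true ∷_) (embs xs ys)) p
... | inj₁ p′ with ∈-map⁻ (true ∷_) p′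
...   | _ , q , refl = take x≤y (∈-embs⁻ xs ys q)
∈-embs⁻ (x ∷ xs) (y ∷ ys) p | true | ofʸ x≤y | inj₂ p′ with ∈-map⁻ (false ∷_) p′
...   | _ , q , refl = skip (∈-embs⁻ (x ∷ xs) ys q)

∈-embs⁺ : ∀ {xs ys bs} → IsEmb xs ys bs → bs ∈ embs xs ys
∈-embs⁺ [] = here refl
∈-embs⁺ {xs = x ∷ xs} {y ∷ ys} (take x≤y e) with x ≤ᵇ y | ≤ᵇ-reflects-≤ x y
... | true | _ = ∈-++⁺ˡ (∈-map⁺ (true ∷_) (∈-embs⁺ e))
... | false | ofⁿ x≰y = contradiction x≤y x≰y
∈-embs⁺ {xs = []} (skip e) = ∈-map⁺ (false ∷_) (∈-embs⁺ e)
∈-embs⁺ {xs = x ∷ xs} {y ∷ ys} (skip e) =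
  ∈-++⁺ʳ (if x ≤ᵇ y then _ else _) (∈-map⁺ (false ∷_) (∈-embs⁺ e))

length-embs : ∀ xs ys → length (embs xs ys) ≡ embeddings xs ys
length-embs [] [] = refl
length-embs [] (y ∷ ys) = trans (List.length-map _ (embs [] ys)) (length-embs [] ys)
length-embs (x ∷ xs) [] = refl
length-embs (x ∷ xs) (y ∷ ys) with x ≤ᵇ y | ≤ᵇ-reflects-≤ x y
... | false | _ = trans (List.length-map _ (embs (x ∷ xs) ys)) (length-embs (x ∷ xs) ys)
... | true | _ = trans (List.length-++ (map (true ∷_) (embs xs ys)))
  (cong₂ _+_ (trans (List.length-map _ (embs xs ys)) (length-embs xs ys))
             (trans (List.length-map _ (embs (x ∷ xs) ys)) (length-embs (x ∷ xs) ys)))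

-- `nothing` is the card on which no ball is caught; it accounts for the
-- diagonal 1 in A_b, and it is the only card from the empty state, as A_0 = (1).
Card : Set
Card = Maybe (List Bool)

data IsCard : List ℕ → Card → List ℕ → Set where
  wait  : ∀ {q} → IsCard q nothing q
  throw : ∀ {x q r bs} → IsEmb q r bs → IsCard (x ∷ q) (just bs) r

waits : List ℕ → List ℕ → List Card
waits q r = if does (List.≡-dec _≟_ q r) then [ nothing ] else []

cards : List ℕ → List ℕ → List Card
cards [] r = waits [] r
cards (x ∷ q) r = map just (embs q r) ++ waits (x ∷ q) r

∈-waits⁻ : ∀ q r {c} → c ∈ waits q r → c ≡ nothing × q ≡ r
∈-waits⁻ q r p with List.≡-dec _≟_ q r
∈-waits⁻ q r (here refl) | yes q≡r = refl , q≡r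

nothing∈waits : ∀ q → nothing ∈ waits q q
nothing∈waits q with List.≡-dec _≟_ q q
... | yes _ = here refl
... | no q≢q = contradiction refl q≢q

waits-unique : ∀ q r → Unique (waits q r)
waits-unique q r with List.≡-dec _≟_ q r
... | yes _ = [] ∷ []
... | no _ = []

cards-unique : ∀ q r → Unique (cards q r)
cards-unique [] r = waits-unique [] r
cards-unique (x ∷ q) r =
  Unique.++⁺ (Unique.map⁺ just-injective (embs-unique q r)) (waits-unique (x ∷ q) r) λ (p , p′) → disjoint p p′
  where
  disjoint : ∀ {c} → c ∈ map just (embs q r) → ¬ (c ∈ waits (x ∷ q) r)
  disjoint p p′ with ∈-map⁻ just p | ∈-waits⁻ (x ∷ q) r p′
  ... | _ , _ , refl | () , _

∈-cards⁻ : ∀ q r {c} → c ∈ cards q r → IsCard q c r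
∈-cards⁻ [] r p with ∈-waits⁻ [] r p
... | refl , refl = wait
∈-cards⁻ (x ∷ q) r p with ∈-++⁻ (map just (embs q r)) p
... | inj₁ p′ with ∈-map⁻ just p′
...   | _ , bs∈ , refl = throw (∈-embs⁻ q r bs∈)
∈-cards⁻ (x ∷ q) r p | inj₂ p′ with ∈-waits⁻ (x ∷ q) r p′
...   | refl , refl = wait

∈-cards⁺ : ∀ {q c r} → IsCard q c r → c ∈ cards q r
∈-cards⁺ {[]} wait = nothing∈waits []
∈-cards⁺ {x ∷ q} wait = ∈-++⁺ʳ (map just (embs q (x ∷ q))) (nothing∈waits (x ∷ q))
∈-cards⁺ (throw e) = ∈-++⁺ˡ (∈-map⁺ just (∈-embs⁺ e))

Step : Set
Step = Card × List ℕ

IsWalk : ∀ {n} → ℕ → List ℕ → Vec Step n → List ℕ → Set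
IsWalk b q [] q′ = q ≡ q′
IsWalk b q ((c , r) ∷ st) q′ = IsComp b r × IsCard q c r × IsWalk b r st q′

ClosedWalk : ℕ → Set
ClosedWalk n = List ℕ × Vec Step n

IsClosed : ∀ {n} → ℕ → ClosedWalk n → Set
IsClosed b (q , st) = IsComp b q × IsWalk b q st q

stepVia : ∀ {n} → List ℕ → Card → Vec Step n → Vec Step (suc n)
stepVia r c st = (c , r) ∷ st

walks : ℕ → ∀ n → List ℕ → List ℕ → List (Vec Step n)
walksVia : ℕ → ∀ n → List ℕ → List ℕ → List ℕ → List (Vec Step (suc n))
walks b zero q q′ = if does (List.≡-dec _≟_ q q′) then [ [] ] else []
walks b (suc n) q q′ = concatMap (walksVia b n q q′) (compositions b)
walksVia b n q q′ r = cartesianProductWith (stepVia r) (cards q r) (walks b n r q′)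

walks-unique : ∀ b n q q′ → Unique (walks b n q q′)
walks-unique b zero q q′ with List.≡-dec _≟_ q q′
... | yes _ = [] ∷ []
... | no _ = []
walks-unique b (suc n) q q′ =
  concatMap-unique (walksVia b n q q′) firstState firstState-via
    (λ r → Unique.cartesianProductWith⁺ (stepVia r) (λ { refl → refl , refl })
             (cards-unique q r) (walks-unique b n r q′))
    (compositions-unique b)
  where
  firstState : Vec Step (suc n) → List ℕ
  firstState ((_ , r) ∷ _) = r
  firstState-via : ∀ r {st} → st ∈ walksVia b n q q′ r → firstState st ≡ r
  firstState-via r st∈ with ∈-cartesianProductWith⁻ (stepVia r) (cards q r) (walks b n r q′) st∈
  ... | _ , _ , _ , _ , refl = refl

∈-walks⁻ : ∀ b n q q′ {st} → st ∈ walks b n q q′ → IsWalk b q st q′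
∈-walks⁻ b zero q q′ p with List.≡-dec _≟_ q q′
∈-walks⁻ b zero q q′ (here refl) | yes q≡q′ = q≡q′
∈-walks⁻ b (suc n) q q′ p with ∈-concatMap-elim (walksVia b n q q′) (compositions b) p
... | r , r∈ , p′ with ∈-cartesianProductWith⁻ (stepVia r) (cards q r) (walks b n r q′) p′
... | c , st , c∈ , st∈ , refl = ∈-compositions⁻ b r∈ , ∈-cards⁻ q r c∈ , ∈-walks⁻ b n r q′ st∈

∈-walks⁺ : ∀ b n q q′ {st} → IsWalk b q st q′ → st ∈ walks b n q q′
∈-walks⁺ b zero q q′ {[]} w with List.≡-dec _≟_ q q′
... | yes _ = here refl
... | no q≢q′ = contradiction w q≢q′
∈-walks⁺ b (suc n) q q′ {(c , r) ∷ st} (r-comp , card , w) =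
  ∈-concatMap-intro (walksVia b n q q′) (∈-compositions⁺ b r-comp)
    (∈-cartesianProductWith⁺ (stepVia r) (∈-cards⁺ card) (∈-walks⁺ b n r q′ w))

closedWalks : ∀ b n → List (ClosedWalk n)
closedWalks b n = concatMap (λ q → map (q ,_) (walks b n q q)) (compositions b)

closedWalks-unique : ∀ b n → Unique (closedWalks b n)
closedWalks-unique b n =
  concatMap-unique (λ q → map (q ,_) (walks b n q q)) proj₁ start
    (λ q → Unique.map⁺ (λ { refl → refl }) (walks-unique b n q q)) (compositions-unique b)
  where
  start : ∀ q {w} → w ∈ map (q ,_) (walks b n q q) → proj₁ w ≡ q
  start q w∈ with ∈-map⁻ (q ,_) w∈
  ... | _ , _ , refl = refl

∈-closedWalks⁻ : ∀ b n {w} → w ∈ closedWalks b n → IsClosed b w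
∈-closedWalks⁻ b n p with ∈-concatMap-elim (λ q → map (q ,_) (walks b n q q)) (compositions b) p
... | q , q∈ , p′ with ∈-map⁻ (q ,_) p′
... | st , st∈ , refl = ∈-compositions⁻ b q∈ , ∈-walks⁻ b n q q st∈

∈-closedWalks⁺ : ∀ b n {w} → IsClosed b w → w ∈ closedWalks b n
∈-closedWalks⁺ b n {q , st} (q-comp , w) =
  ∈-concatMap-intro (λ q → map (q ,_) (walks b n q q)) (∈-compositions⁺ b q-comp)
    (∈-map⁺ (q ,_) (∈-walks⁺ b n q q w))

-- Traces of powers count closed walks

length-waits : ∀ q r → length (waits q r) ≡ (if does (List.≡-dec _≟_ q r) then 1 else 0)
length-waits q r with List.≡-dec _≟_ q r
... | yes _ = refl
... | no _ = refl

A≡length-cards : ∀ b i j → A b i j ≡ length (cards (List.lookup (compositions b) i) (List.lookup (compositions b) j))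
A≡length-cards zero zero zero = refl
A≡length-cards (suc b) i j =
  helper (List.lookup (compositions (suc b)) i) (List.lookup (compositions (suc b)) j)
    (∈-compositions⁻ (suc b) (∈-lookup {xs = compositions (suc b)} i))
  where
  helper : ∀ q r → IsComp (suc b) q →
    nontrivialEmbeddings q r + (if does (List.≡-dec _≟_ q r) then 1 else 0) ≡ length (cards q r)
  helper [] r (_ , ())
  helper (x ∷ q) r _ = sym (trans (List.length-++ (map just (embs q r)))
    (cong₂ _+_ (trans (List.length-map just (embs q r)) (length-embs q r)) (length-waits (x ∷ q) r)))

power≡length-walks : ∀ b n i j →
  (A b ^ᴹ n) i j ≡ length (walks b n (List.lookup (compositions b) i) (List.lookup (compositions b) j))
-- `identity` compares indices, a walk of length 0 compares compositions; the tests agree because no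
-- composition is listed twice.
power≡length-walks b zero i j
  with i Fin.≟ j | List.≡-dec _≟_ (List.lookup (compositions b) i) (List.lookup (compositions b) j)
... | yes _ | yes _ = refl
... | no _ | no _ = refl
... | yes refl | no ≢ = contradiction refl ≢
... | no ≢ | yes eq = contradiction (lookup-injective (compositions-unique b) i j eq) ≢
power≡length-walks b (suc n) i j = begin
  sum (map (λ k → A b i k * (A b ^ᴹ n) k j) (allFin (dim b)))
    ≡⟨ cong sum (List.map-cong (λ k → trans (cong₂ _*_ (A≡length-cards b i k) (power≡length-walks b n k j))
         (sym (length-cartesianProductWith (stepVia (List.lookup cs k)) (cards q (List.lookup cs k)) _))) (allFin (dim b))) ⟩
  sum (map (λ k → length (walksVia b n q q′ (List.lookup cs k))) (allFin (dim b)))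
    ≡⟨ sum-map-lookup (length ∘ walksVia b n q q′) cs ⟩
  sum (map (length ∘ walksVia b n q q′) cs)
    ≡⟨ length-concatMap (walksVia b n q q′) cs ⟨
  length (walks b (suc n) q q′) ∎
  where
  open ≡-Reasoning
  cs = compositions b
  q = List.lookup cs i
  q′ = List.lookup cs j

trace≡length-closedWalks : ∀ b n → trace (A b ^ᴹ n) ≡ length (closedWalks b n)
trace≡length-closedWalks b n = begin
  sum (map (λ i → (A b ^ᴹ n) i i) (allFin (dim b)))
    ≡⟨ cong sum (List.map-cong (λ i → trans (power≡length-walks b n i i)
         (sym (List.length-map (List.lookup cs i ,_) (walks b n (List.lookup cs i) (List.lookup cs i))))) (allFin (dim b))) ⟩
  sum (map (λ i → length (f (List.lookup cs i))) (allFin (dim b)))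
    ≡⟨ sum-map-lookup (length ∘ f) cs ⟩
  sum (map (length ∘ f) cs)
    ≡⟨ length-concatMap f cs ⟨
  length (closedWalks b n) ∎
  where
  open ≡-Reasoning
  cs = compositions b
  f : List ℕ → List (ClosedWalk n)
  f q = map (q ,_) (walks b n q q)

unique-length : ∀ {X : Set} {xs ys : List X} → Unique xs → Unique ys →
  (∀ {x} → x ∈ xs → x ∈ ys) → (∀ {x} → x ∈ ys → x ∈ xs) → length xs ≡ length ys
unique-length u v f g = ↭-length (∼bag⇒↭ (unique∧set⇒bag u v (mk⇔ f g)))

length-filter-split : ∀ {X : Set} {P : X → Set} (P? : Decidable P) (xs : List X) →
  length (filter P? xs) + length (filter (¬? ∘ P?) xs) ≡ length xs
length-filter-split P? [] = refl
length-filter-split P? (x ∷ xs) with P? x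
... | yes _ = cong suc (length-filter-split P? xs)
... | no _ = trans (+-suc _ _) (cong suc (length-filter-split P? xs))

sum-∷ʳ : ∀ q y → sum (q ∷ʳ y) ≡ sum q + y
sum-∷ʳ q y = trans (sum-++ q [ y ]) (cong (sum q +_) (+-identityʳ y))

-- Walks whose last group is never caught

lastTrue : List Bool → Bool
lastTrue [] = false
lastTrue (b ∷ []) = b
lastTrue (_ ∷ b ∷ bs) = lastTrue (b ∷ bs)

-- The empty state has no last group to keep. With `false` there, the only closed walk for `b = 0`
-- is free, as it must be to account for the empty pattern. For a throw, order preservation makes
-- the last entry of the mask decisive.
keepsTop : List ℕ → Card → Bool
keepsTop [] nothing = false
keepsTop (_ ∷ _) nothing = true
keepsTop q (just bs) = lastTrue bs

keepsTopAlong : ∀ {n} → List ℕ → Vec Step n → Bool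
keepsTopAlong q [] = true
keepsTopAlong q ((c , r) ∷ st) = keepsTop q c ∧ keepsTopAlong r st

TopFixed : ∀ {n} → ClosedWalk n → Set
TopFixed (q , st) = keepsTopAlong q st ≡ true

topFixed? : ∀ {n} → Decidable (TopFixed {n})
topFixed? (q , st) = keepsTopAlong q st Bool.≟ true

∧-true⁻ : ∀ a {b} → a ∧ b ≡ true → a ≡ true × b ≡ true
∧-true⁻ true b≡true = refl , b≡true

addTopCard : Card → Card
addTopCard nothing = nothing
addTopCard (just bs) = just (bs ∷ʳ true)

addTopStep : ℕ → Step → Step
addTopStep y (c , r) = addTopCard c , r ∷ʳ y

addTop : ∀ {n} → ℕ → ClosedWalk n → ClosedWalk n
addTop y (q , st) = q ∷ʳ y , Vec.map (addTopStep y) st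

addTopCard-injective : ∀ c c′ → addTopCard c ≡ addTopCard c′ → c ≡ c′
addTopCard-injective nothing nothing _ = refl
addTopCard-injective (just bs) (just bs′) eq =
  cong just (List.∷ʳ-injectiveˡ bs bs′ (just-injective eq))

addTopSteps-injective : ∀ {n} y (st st′ : Vec Step n) →
  Vec.map (addTopStep y) st ≡ Vec.map (addTopStep y) st′ → st ≡ st′
addTopSteps-injective y [] [] _ = refl
addTopSteps-injective y ((c , r) ∷ st) ((c′ , r′) ∷ st′) eq with Vec.∷-injective eq
... | step≡ , st≡ = cong₂ _∷_
  (cong₂ _,_ (addTopCard-injective c c′ (cong proj₁ step≡)) (List.∷ʳ-injectiveˡ r r′ (cong proj₂ step≡)))
  (addTopSteps-injective y st st′ st≡)

addTop-injective : ∀ {n} y {w w′ : ClosedWalk n} → addTop y w ≡ addTop y w′ → w ≡ w′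
addTop-injective y {q , st} {q′ , st′} eq =
  cong₂ _,_ (List.∷ʳ-injectiveˡ q q′ (cong proj₁ eq)) (addTopSteps-injective y st st′ (cong proj₂ eq))

lastTrue-∷ʳ : ∀ bs → lastTrue (bs ∷ʳ true) ≡ true
lastTrue-∷ʳ [] = refl
lastTrue-∷ʳ (b ∷ []) = refl
lastTrue-∷ʳ (_ ∷ b ∷ bs) = lastTrue-∷ʳ (b ∷ bs)

keepsTop-addTop : ∀ q y c → keepsTop (q ∷ʳ y) (addTopCard c) ≡ true
keepsTop-addTop [] y nothing = refl
keepsTop-addTop (_ ∷ _) y nothing = refl
keepsTop-addTop [] y (just bs) = lastTrue-∷ʳ bs
keepsTop-addTop (_ ∷ _) y (just bs) = lastTrue-∷ʳ bs

addTop-topFixed : ∀ {n} y (w : ClosedWalk n) → TopFixed (addTop y w)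
addTop-topFixed y (q , st) = along q st
  where
  along : ∀ {n} q (st : Vec Step n) → keepsTopAlong (q ∷ʳ y) (Vec.map (addTopStep y) st) ≡ true
  along q [] = refl
  along q ((c , r) ∷ st) rewrite keepsTop-addTop q y c = along r st

IsComp-∷ʳ : ∀ {i y q} → 1 ≤ y → IsComp i q → IsComp (i + y) (q ∷ʳ y)
IsComp-∷ʳ {y = y} {q} 1≤y (pos , eq) = All.++⁺ pos (1≤y ∷ []) , trans (sum-∷ʳ q y) (cong (_+ y) eq)

IsComp-∷ʳ⁻ : ∀ {i y q} → IsComp (i + y) (q ∷ʳ y) → IsComp i q
IsComp-∷ʳ⁻ {i} {y} {q} (pos , eq) = All.++⁻ˡ q pos , +-cancelʳ-≡ y (sum q) i (trans (sym (sum-∷ʳ q y)) eq)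

IsEmb-∷ʳ : ∀ {x y xs ys bs} → x ≤ y → IsEmb xs ys bs → IsEmb (xs ∷ʳ x) (ys ∷ʳ y) (bs ∷ʳ true)
IsEmb-∷ʳ x≤y [] = take x≤y []
IsEmb-∷ʳ x≤y (take p e) = take p (IsEmb-∷ʳ x≤y e)
IsEmb-∷ʳ x≤y (skip e) = skip (IsEmb-∷ʳ x≤y e)

addTop-isCard : ∀ {y q c r} → IsCard q c r → IsCard (q ∷ʳ y) (addTopCard c) (r ∷ʳ y)
addTop-isCard wait = wait
addTop-isCard (throw e) = throw (IsEmb-∷ʳ ≤-refl e)

addTop-isWalk : ∀ {n i y q q′} → 1 ≤ y → (st : Vec Step n) → IsWalk i q st q′ →
  IsWalk (i + y) (q ∷ʳ y) (Vec.map (addTopStep y) st) (q′ ∷ʳ y)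
addTop-isWalk 1≤y [] refl = refl
addTop-isWalk 1≤y (_ ∷ st) (comp , card , w) =
  IsComp-∷ʳ 1≤y comp , addTop-isCard card , addTop-isWalk 1≤y st w

addTop-isClosed : ∀ {n i y} {w : ClosedWalk n} → 1 ≤ y → IsClosed i w → IsClosed (i + y) (addTop y w)
addTop-isClosed {w = q , st} 1≤y (comp , w) = IsComp-∷ʳ 1≤y comp , addTop-isWalk 1≤y st w

lastTrue-∷⁻ : ∀ b bs → lastTrue (b ∷ bs) ≡ true → (bs ≡ [] × b ≡ true) ⊎ lastTrue bs ≡ true
lastTrue-∷⁻ b [] eq = inj₁ (refl , eq)
lastTrue-∷⁻ b (_ ∷ _) eq = inj₂ eq

-- By monotonicity only the last entry of `xs` can be sent to the last entry of `ys`; cutting off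
-- both leaves an embedding.
IsEmb-lastTrue : ∀ {xs ys bs} → IsEmb xs ys bs → lastTrue bs ≡ true →
  ∃₂ λ xs₀ x → ∃₂ λ ys₀ y → ∃ λ bs₀ →
    xs ≡ xs₀ ∷ʳ x × ys ≡ ys₀ ∷ʳ y × bs ≡ bs₀ ∷ʳ true × x ≤ y × IsEmb xs₀ ys₀ bs₀
IsEmb-lastTrue (take {x} {y} {bs = bs} p e) eq with lastTrue-∷⁻ true bs eq
IsEmb-lastTrue (take {x} {y} p []) eq | inj₁ _ = [] , x , [] , y , [] , refl , refl , refl , p , []
... | inj₂ eq′ with IsEmb-lastTrue e eq′
...   | xs₀ , x₀ , ys₀ , y₀ , bs₀ , xs≡ , ys≡ , bs≡ , x≤y , e₀ =
  x ∷ xs₀ , x₀ , y ∷ ys₀ , y₀ , true ∷ bs₀ ,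
  cong (x ∷_) xs≡ , cong (y ∷_) ys≡ , cong (true ∷_) bs≡ , x≤y , take p e₀
IsEmb-lastTrue (skip {y} {bs = bs} e) eq with lastTrue-∷⁻ false bs eq
... | inj₂ eq′ with IsEmb-lastTrue e eq′
...   | xs₀ , x₀ , ys₀ , y₀ , bs₀ , xs≡ , ys≡ , bs≡ , x≤y , e₀ =
  xs₀ , x₀ , y ∷ ys₀ , y₀ , false ∷ bs₀ ,
  xs≡ , cong (y ∷_) ys≡ , cong (false ∷_) bs≡ , x≤y , skip e₀

dropTop-isCard : ∀ p x {c r} → IsCard (p ∷ʳ x) c r → keepsTop (p ∷ʳ x) c ≡ true →
  ∃₂ λ r₀ y → ∃ λ c₀ → r ≡ r₀ ∷ʳ y × c ≡ addTopCard c₀ × x ≤ y × IsCard p c₀ r₀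
dropTop-isCard [] x wait _ = [] , x , nothing , refl , refl , ≤-refl , wait
dropTop-isCard (z ∷ p) x wait _ = z ∷ p , x , nothing , refl , refl , ≤-refl , wait
dropTop-isCard [] x (throw e) eq with IsEmb-lastTrue e eq
... | [] , _ , _ , _ , _ , () , _
... | _ ∷ _ , _ , _ , _ , _ , () , _
dropTop-isCard (z ∷ p) x (throw e) eq with IsEmb-lastTrue e eq
... | p₀ , x₀ , r₀ , y , bs₀ , p≡ , refl , refl , x≤y , e₀ with List.∷ʳ-injective p p₀ p≡
... | refl , refl = r₀ , y , just bs₀ , refl , refl , x≤y , throw e₀

-- Along the walk the size of the last group can only grow.
dropTop-isWalk : ∀ {n i p x p′ x′} (st : Vec Step n) → IsWalk (i + x) (p ∷ʳ x) st (p′ ∷ʳ x′) →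
  keepsTopAlong (p ∷ʳ x) st ≡ true →
  x ≤ x′ × (x ≡ x′ → ∃ λ st₀ → st ≡ Vec.map (addTopStep x) st₀ × IsWalk i p st₀ p′)
dropTop-isWalk {p = p} {p′ = p′} [] eq _ with List.∷ʳ-injective p p′ eq
... | refl , refl = ≤-refl , λ _ → [] , refl , refl
dropTop-isWalk {i = i} {p} {x} {p′} {x′} ((c , r) ∷ st) (comp , card , w) keeps
  with ∧-true⁻ (keepsTop (p ∷ʳ x) c) keeps
... | k , ks with dropTop-isCard p x card k
... | r₀ , y , c₀ , refl , refl , x≤y , card₀ = ≤-trans x≤y y≤x′ , conclude
  where
  -- The size `y` after the first card is not yet known to be `x`, so the total is split anew to fit
  -- the recursive call.
  b≡ : i + x ≡ i + x ∸ y + y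
  b≡ = sym (m∸n+n≡m (subst (y ≤_) (proj₂ comp) (subst (y ≤_) (sym (sum-∷ʳ r₀ y)) (m≤n+m y (sum r₀)))))
  y≤x′ : y ≤ x′
  y≤x′ = proj₁ (dropTop-isWalk {p = r₀} {p′ = p′} st (subst (λ b → IsWalk b (r₀ ∷ʳ y) st (p′ ∷ʳ x′)) b≡ w) ks)
  conclude : x ≡ x′ → ∃ λ st₀ → (addTopCard c₀ , r₀ ∷ʳ y) ∷ st ≡ Vec.map (addTopStep x) st₀ × IsWalk i p st₀ p′
  conclude refl with ≤-antisym x≤y y≤x′
  ... | refl with proj₂ (dropTop-isWalk {p = r₀} {p′ = p′} st w ks) refl
  ... | st₀ , refl , w₀ = (c₀ , r₀) ∷ st₀ , refl , IsComp-∷ʳ⁻ comp , card₀ , w₀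

nonempty-keepsTop : ∀ {q c r} → IsCard q c r → keepsTop q c ≡ true → ∃₂ λ p x → q ≡ p ∷ʳ x
nonempty-keepsTop {q} card keeps with initLast q
... | p ∷ʳ′ x = p , x , refl
nonempty-keepsTop wait () | []

-- Here `i` counts the balls outside the last group, and `i < b` because that group is nonempty. The
-- walk has a first card, and its keeping a last group excludes the empty state.
dropTop-isClosed : ∀ {n b} .{{_ : NonZero n}} {w : ClosedWalk n} → IsClosed b w → TopFixed w →
  ∃ λ i → i < b × ∃ λ w₀ → IsClosed i w₀ × w ≡ addTop (b ∸ i) w₀
dropTop-isClosed {b = b} {q , st@((c , r) ∷ _)} ((pos , sum≡) , w@(_ , card , _)) keeps
  with nonempty-keepsTop card (proj₁ (∧-true⁻ (keepsTop q c) keeps))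
... | p , x , refl with trans (sym (sum-∷ʳ p x)) sum≡
... | refl with proj₂ (dropTop-isWalk {p = p} {p′ = p} st w keeps) refl
... | st₀ , eq , w₀ =
  sum p , m<m+n (sum p) (All.lookup pos (∈-++⁺ʳ p (here refl))) ,
  (p , st₀) , ((All.++⁻ˡ p pos , refl) , w₀) ,
  subst (λ y → (p ∷ʳ x , st) ≡ (p ∷ʳ y , Vec.map (addTopStep y) st₀)) (sym (m+n∸m≡n (sum p) x)) (cong (_ ,_) eq)

-- `b ∸ i` is the only size of an added group that brings `i` balls up to `b`.
fixedTopWalks : ∀ b n → List (ClosedWalk n)
fixedTopWalks b n = concatMap (λ i → map (addTop (b ∸ i)) (closedWalks i n)) (upTo b)

-- Recovers `i` from the start of a walk in `fixedTopWalks`, which keeps the blocks for different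
-- `i` apart.
sumInit : List ℕ → ℕ
sumInit [] = 0
sumInit (x ∷ []) = 0
sumInit (x ∷ y ∷ q) = x + sumInit (y ∷ q)

sumInit-∷ʳ : ∀ q y → sumInit (q ∷ʳ y) ≡ sum q
sumInit-∷ʳ [] y = refl
sumInit-∷ʳ (x ∷ []) y = refl
sumInit-∷ʳ (x ∷ z ∷ q) y = cong (x +_) (sumInit-∷ʳ (z ∷ q) y)

fixedTopWalks-unique : ∀ b n → Unique (fixedTopWalks b n)
fixedTopWalks-unique b n =
  concatMap-unique (λ i → map (addTop (b ∸ i)) (closedWalks i n)) (sumInit ∘ proj₁) key
    (λ i → Unique.map⁺ (addTop-injective (b ∸ i)) (closedWalks-unique i n)) (Unique.upTo⁺ b)
  where
  key : ∀ i {w} → w ∈ map (addTop (b ∸ i)) (closedWalks i n) → sumInit (proj₁ w) ≡ i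
  key i w∈ with ∈-map⁻ (addTop (b ∸ i)) w∈
  ... | (q , st) , w₀∈ , refl = trans (sumInit-∷ʳ q (b ∸ i)) (proj₂ (proj₁ (∈-closedWalks⁻ i n w₀∈)))

length-topFixed : ∀ b n .{{_ : NonZero n}} →
  length (filter topFixed? (closedWalks b n)) ≡ sum (map (λ i → trace (A i ^ᴹ n)) (upTo b))
length-topFixed b n = begin
  length (filter topFixed? (closedWalks b n))
    ≡⟨ unique-length (Unique.filter⁺ topFixed? (closedWalks-unique b n)) (fixedTopWalks-unique b n) ⊆ ⊇ ⟩
  length (fixedTopWalks b n)
    ≡⟨ length-concatMap f (upTo b) ⟩
  sum (map (length ∘ f) (upTo b))
    ≡⟨ cong sum (List.map-cong (λ i → trans (List.length-map (addTop (b ∸ i)) (closedWalks i n))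
         (sym (trace≡length-closedWalks i n))) (upTo b)) ⟩
  sum (map (λ i → trace (A i ^ᴹ n)) (upTo b)) ∎
  where
  open ≡-Reasoning
  f : ℕ → List (ClosedWalk n)
  f i = map (addTop (b ∸ i)) (closedWalks i n)
  ⊆ : ∀ {w} → w ∈ filter topFixed? (closedWalks b n) → w ∈ fixedTopWalks b n
  ⊆ w∈ with ∈-filter⁻ topFixed? {xs = closedWalks b n} w∈
  ... | w∈′ , fixed with dropTop-isClosed (∈-closedWalks⁻ b n w∈′) fixed
  ... | i , i<b , w₀ , closed , refl =
    ∈-concatMap-intro f (∈-upTo⁺ i<b) (∈-map⁺ (addTop (b ∸ i)) (∈-closedWalks⁺ i n closed))
  ⊇ : ∀ {w} → w ∈ fixedTopWalks b n → w ∈ filter topFixed? (closedWalks b n)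
  ⊇ w∈ with ∈-concatMap-elim f (upTo b) w∈
  ... | i , i∈ , w∈′ with ∈-map⁻ (addTop (b ∸ i)) w∈′
  ... | w₀ , w₀∈ , refl =
    ∈-filter⁺ topFixed? (∈-closedWalks⁺ b n {addTop (b ∸ i) w₀} (subst (λ a → IsClosed a (addTop (b ∸ i) w₀)) (m+[n∸m]≡n (<⇒≤ i<b))
      (addTop-isClosed {w = w₀} (m<n⇒0<n∸m i<b) (∈-closedWalks⁻ i n w₀∈)))) (addTop-topFixed (b ∸ i) w₀)
    where i<b = ∈-upTo⁻ i∈

-- Finite sums, finite supports and multiplicities

Σ< : ℕ → (ℕ → ℕ) → ℕ
Σ< zero f = 0
Σ< (suc N) f = f 0 + Σ< N (f ∘ suc)

Σ<-cong : ∀ N {f g : ℕ → ℕ} → (∀ i → f i ≡ g i) → Σ< N f ≡ Σ< N g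
Σ<-cong zero eq = refl
Σ<-cong (suc N) eq = cong₂ _+_ (eq 0) (Σ<-cong N (eq ∘ suc))

Σ<-zero : ∀ N {f : ℕ → ℕ} → (∀ i → f i ≡ 0) → Σ< N f ≡ 0
Σ<-zero zero eq = refl
Σ<-zero (suc N) eq = cong₂ _+_ (eq 0) (Σ<-zero N (eq ∘ suc))

+-interchange : ∀ a b c d → (a + b) + (c + d) ≡ (a + c) + (b + d)
+-interchange = solve-∀

Σ<-+ : ∀ N (f g : ℕ → ℕ) → Σ< N (λ i → f i + g i) ≡ Σ< N f + Σ< N g
Σ<-+ zero f g = refl
Σ<-+ (suc N) f g = trans (cong (f 0 + g 0 +_) (Σ<-+ N (f ∘ suc) (g ∘ suc)))
  (+-interchange (f 0) (g 0) (Σ< N (f ∘ suc)) (Σ< N (g ∘ suc)))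

Σ<-last : ∀ N (f : ℕ → ℕ) → Σ< (suc N) f ≡ Σ< N f + f N
Σ<-last zero f = +-identityʳ (f 0)
Σ<-last (suc N) f = trans (cong (f 0 +_) (Σ<-last N (f ∘ suc))) (sym (+-assoc (f 0) _ _))

Below : ℕ → (ℕ → ℕ) → Set
Below N f = ∀ i → N ≤ i → f i ≡ 0

Below-mono : ∀ {N M f} → N ≤ M → Below N f → Below M f
Below-mono N≤M below i M≤i = below i (≤-trans N≤M M≤i)

Σ<-below : ∀ {N f} M → Below N f → Σ< (N + M) f ≡ Σ< N f
Σ<-below {zero} M below = Σ<-zero M (λ i → below i z≤n)
Σ<-below {suc N} {f} M below = cong (f 0 +_) (Σ<-below M (λ i N≤i → below (suc i) (s≤s N≤i)))

Σ<-below-suc : ∀ {N f} → Below N f → f 0 + Σ< N (f ∘ suc) ≡ Σ< N f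
Σ<-below-suc {N} {f} below =
  trans (Σ<-last N f) (trans (cong (Σ< N f +_) (below N ≤-refl)) (+-identityʳ _))

δ : ℕ → ℕ → ℕ
δ zero zero = 1
δ zero (suc _) = 0
δ (suc _) zero = 0
δ (suc x) (suc y) = δ x y

δ-refl : ∀ x → δ x x ≡ 1
δ-refl zero = refl
δ-refl (suc x) = δ-refl x

δ-≢ : ∀ x y → x ≢ y → δ x y ≡ 0
δ-≢ zero zero x≢y = contradiction refl x≢y
δ-≢ zero (suc y) x≢y = refl
δ-≢ (suc x) zero x≢y = refl
δ-≢ (suc x) (suc y) x≢y = δ-≢ x y (x≢y ∘ cong suc)

δ-shift : ∀ o x y → δ (o + x) (o + y) ≡ δ x y
δ-shift zero x y = refl
δ-shift (suc o) x y = δ-shift o x y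

Σ<-δ : ∀ {N x} (φ : ℕ → ℕ) → x < N → Σ< N (λ i → φ i * δ x i) ≡ φ x
Σ<-δ {suc N} {zero} φ _ = trans (cong₂ _+_ (*-identityʳ (φ 0)) (Σ<-zero N (λ i → *-zeroʳ (φ (suc i))))) (+-identityʳ _)
Σ<-δ {suc N} {suc x} φ (s≤s x<N) = cong₂ _+_ (*-zeroʳ (φ 0)) (Σ<-δ (φ ∘ suc) x<N)

mult : List ℕ → ℕ → ℕ
mult [] u = 0
mult (h ∷ T) u = δ h u + mult T u

mult-shift : ∀ o T u → mult (map (o +_) T) (o + u) ≡ mult T u
mult-shift o [] u = refl
mult-shift o (h ∷ T) u = cong₂ _+_ (δ-shift o h u) (mult-shift o T u)

mult-∉ : ∀ T u → All (_≢ u) T → mult T u ≡ 0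
mult-∉ [] u [] = refl
mult-∉ (h ∷ T) u (h≢u ∷ T≢u) = cong₂ _+_ (δ-≢ h u h≢u) (mult-∉ T u T≢u)

-- Exchanges the sum over `i` with the sum over the entries of `T`. Heights start at 1 and positions
-- in a state at 0, hence `suc` and `pred`. The weights used are `φ = 1` for lengths and `φ i = i`
-- for sums.
Σ<-mult : ∀ {N} (φ : ℕ → ℕ) {T} → Pos T → All (_≤ N) T →
  Σ< N (λ i → φ i * mult T (suc i)) ≡ sum (map (φ ∘ pred) T)
Σ<-mult {N} φ [] [] = Σ<-zero N (λ i → *-zeroʳ (φ i))
Σ<-mult {N} φ {suc h ∷ T} (_ ∷ pos) (h<N ∷ low) = begin
  Σ< N (λ i → φ i * (δ h i + mult T (suc i)))
    ≡⟨ Σ<-cong N (λ i → *-distribˡ-+ (φ i) (δ h i) _) ⟩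
  Σ< N (λ i → φ i * δ h i + φ i * mult T (suc i))
    ≡⟨ Σ<-+ N _ _ ⟩
  Σ< N (λ i → φ i * δ h i) + Σ< N (λ i → φ i * mult T (suc i))
    ≡⟨ cong₂ _+_ (Σ<-δ φ h<N) (Σ<-mult φ pos low) ⟩
  φ h + sum (map (φ ∘ pred) T) ∎
  where open ≡-Reasoning

Σ<-mult-length : ∀ {N T} → Pos T → All (_≤ N) T → Σ< N (λ i → mult T (suc i)) ≡ length T
Σ<-mult-length {N} {T} pos low =
  trans (Σ<-cong N (λ i → sym (*-identityˡ (mult T (suc i))))) (trans (Σ<-mult (λ _ → 1) pos low) (count T))
  where
  count : ∀ (T : List ℕ) → sum (map (λ _ → 1) T) ≡ length T
  count [] = refl
  count (_ ∷ T) = cong suc (count T)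

Σ<-mult-sum : ∀ {N T} → Pos T → All (_≤ N) T → Σ< N (λ i → i * mult T (suc i)) + length T ≡ sum T
Σ<-mult-sum {N} {T} pos low = trans (cong (_+ length T) (Σ<-mult (λ i → i) pos low)) (sum-map-pred pos)
  where
  sum-map-pred : ∀ {T} → Pos T → sum (map pred T) + length T ≡ sum T
  sum-map-pred [] = refl
  sum-map-pred {suc h ∷ T} (_ ∷ pos) = begin
    h + sum (map pred T) + suc (length T) ≡⟨ +-suc _ (length T) ⟩
    suc (h + sum (map pred T) + length T) ≡⟨ cong suc (+-assoc h _ _) ⟩
    suc (h + (sum (map pred T) + length T)) ≡⟨ cong (λ x → suc (h + x)) (sum-map-pred pos) ⟩
    suc (h + sum T) ∎
    where open ≡-Reasoning

-- Juggling states

-- A state f has f i balls landing i time steps from now; T is thrown now.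
next : List ℕ → (ℕ → ℕ) → ℕ → ℕ
next T f i = f (suc i) + mult T (suc i)

-- Intermediate states are not stored, since `next` computes them from the first state and the
-- throws. The final state is compared pointwise only.
Chain : ∀ {m} → (ℕ → ℕ) → Vec (List ℕ) m → (ℕ → ℕ) → Set
Chain f [] f′ = ∀ i → f i ≡ f′ i
Chain f (T ∷ Ts) f′ = IsMultiset⁺ T × length T ≡ f 0 × Chain (next T f) Ts f′

Chain-congˡ : ∀ {m f g f′} (Ts : Vec (List ℕ) m) → (∀ i → f i ≡ g i) → Chain f Ts f′ → Chain g Ts f′
Chain-congˡ [] f≗g c i = trans (sym (f≗g i)) (c i)
Chain-congˡ (T ∷ Ts) f≗g (ms , len , c) =
  ms , trans len (f≗g 0) , Chain-congˡ Ts (λ i → cong (_+ mult T (suc i)) (f≗g (suc i))) c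

Chain-congʳ : ∀ {m f f′ g′} (Ts : Vec (List ℕ) m) → (∀ i → f′ i ≡ g′ i) → Chain f Ts f′ → Chain f Ts g′
Chain-congʳ [] f′≗g′ c i = trans (c i) (f′≗g′ i)
Chain-congʳ (T ∷ Ts) f′≗g′ (ms , len , c) = ms , len , Chain-congʳ Ts f′≗g′ c

Chain-multisets : ∀ {m f f′} (Ts : Vec (List ℕ) m) → Chain f Ts f′ → VAll.All IsMultiset⁺ Ts
Chain-multisets [] c = []
Chain-multisets (T ∷ Ts) (ms , _ , c) = ms ∷ Chain-multisets Ts c

-- The number of throws of Ts landing at time u, if the first throw is made at time o.
landing : ∀ {m} → ℕ → Vec (List ℕ) m → ℕ → ℕ
landing o [] u = 0
landing o (T ∷ Ts) u = mult (map (o +_) T) u + landing (suc o) Ts u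

landing-early : ∀ {m} o (Ts : Vec (List ℕ) m) u → VAll.All IsMultiset⁺ Ts → u ≤ o → landing o Ts u ≡ 0
landing-early o [] u [] u≤o = refl
landing-early o (T ∷ Ts) u ((_ , pos) ∷ ms) u≤o = cong₂ _+_
  (mult-∉ (map (o +_) T) u (shifted pos))
  (landing-early (suc o) Ts u ms (m≤n⇒m≤1+n u≤o))
  where
  shifted : ∀ {T} → Pos T → All (_≢ u) (map (o +_) T)
  shifted [] = []
  shifted {h ∷ _} (0<h ∷ pos) = (λ eq → <-irrefl (sym eq) (≤-<-trans u≤o (m<m+n o 0<h))) ∷ shifted pos

-- The last throw is made at time `o + m - 1` and has height at most `N`.
landing-late : ∀ {m N} o (Ts : Vec (List ℕ) m) u → VAll.All (All (_≤ N)) Ts → o + (m + N) ≤ u → landing o Ts u ≡ 0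
landing-late o [] u [] _ = refl
landing-late {suc m} {N} o (T ∷ Ts) u (low ∷ lows) late = cong₂ _+_
  (mult-∉ (map (o +_) T) u (shifted low))
  (landing-late (suc o) Ts u lows late′)
  where
  late′ : suc o + (m + N) ≤ u
  late′ = subst (_≤ u) (+-suc o (m + N)) late
  shifted : ∀ {T} → All (_≤ N) T → All (_≢ u) (map (o +_) T)
  shifted [] = []
  shifted {h ∷ _} (h≤N ∷ low) =
    (λ eq → <-irrefl eq (≤-trans (s≤s (+-monoʳ-≤ o (≤-trans h≤N (m≤n+m N m)))) late′)) ∷ shifted low

-- The balls of `T` may be counted in the state after the throw or among the landings; `mult-shift`
-- changes between the two clocks.
next-landing : ∀ {m} o T (Ts : Vec (List ℕ) m) f v →
  next T f v + landing (suc o) Ts (suc o + v) ≡ f (suc v) + landing o (T ∷ Ts) (o + suc v)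
next-landing o T Ts f v = begin
  f (suc v) + mult T (suc v) + landing (suc o) Ts (suc o + v)
    ≡⟨ +-assoc (f (suc v)) _ _ ⟩
  f (suc v) + (mult T (suc v) + landing (suc o) Ts (suc o + v))
    ≡⟨ cong (f (suc v) +_) (cong₂ _+_ (sym (mult-shift o T (suc v))) (cong (landing (suc o) Ts) (sym (+-suc o v)))) ⟩
  f (suc v) + landing o (T ∷ Ts) (o + suc v) ∎
  where open ≡-Reasoning

Chain-end : ∀ {m f f′} o (Ts : Vec (List ℕ) m) → Chain f Ts f′ →
  ∀ i → f′ i ≡ f (m + i) + landing o Ts (o + (m + i))
Chain-end o [] c i = trans (sym (c i)) (sym (+-identityʳ _))
Chain-end {suc m} {f} o (T ∷ Ts) (_ , _ , c) i = trans (Chain-end (suc o) Ts c i) (next-landing o T Ts f (m + i))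

-- `landing` also counts throws made at or after time `o + t`, but positive heights make these land
-- later still.
Chain-length : ∀ {m f f′} o (Ts : Vec (List ℕ) m) → Chain f Ts f′ →
  ∀ t → length (Vec.lookup Ts t) ≡ f (toℕ t) + landing o Ts (o + toℕ t)
Chain-length {f = f} o (T ∷ Ts) c@(_ , len , _) zero = begin
  length T                                  ≡⟨ len ⟩
  f 0                                       ≡⟨ +-identityʳ _ ⟨
  f 0 + 0                                   ≡⟨ cong (f 0 +_) (landing-early o (T ∷ Ts) (o + 0)
                                                 (Chain-multisets {f = f} (T ∷ Ts) c) (≤-reflexive (+-identityʳ o))) ⟨
  f 0 + landing o (T ∷ Ts) (o + 0)          ∎
  where open ≡-Reasoning
Chain-length {f = f} o (T ∷ Ts) (_ , _ , c) (suc t) =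
  trans (Chain-length (suc o) Ts c t) (next-landing o T Ts f (toℕ t))

-- Converse of `Chain-end` and `Chain-length`: their global landing equations already imply every
-- single step.
Chain-intro : ∀ {m f f′} o (Ts : Vec (List ℕ) m) → VAll.All IsMultiset⁺ Ts →
  (∀ t → length (Vec.lookup Ts t) ≡ f (toℕ t) + landing o Ts (o + toℕ t)) →
  (∀ i → f′ i ≡ f (m + i) + landing o Ts (o + (m + i))) → Chain f Ts f′
Chain-intro o [] [] len end i = sym (trans (end i) (+-identityʳ _))
Chain-intro {suc m} {f} o (T ∷ Ts) (ms ∷ mss) len end =
  ms ,
  trans (len zero) (trans (cong (f 0 +_) (landing-early o (T ∷ Ts) (o + 0) (ms ∷ mss) (≤-reflexive (+-identityʳ o))))
    (+-identityʳ _)) ,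
  Chain-intro (suc o) Ts mss (λ t → trans (len (suc t)) (sym (next-landing o T Ts f (toℕ t))))
    (λ i → trans (end i) (sym (next-landing o T Ts f (m + i))))

-- Iterating f i ≡ f (n + i) + landing 0 Ts (n + i) exhausts the support of f.
closed-unique : ∀ {n N f g} .{{_ : NonZero n}} (Ts : Vec (List ℕ) n) → Below N f → Below N g →
  Chain f Ts f → Chain g Ts g → ∀ i → f i ≡ g i
closed-unique {n} {N} {f} {g} Ts below-f below-g cf cg i = descend N i (m≤m+n N i)
  where
  descend : ∀ k i → N ≤ k + i → f i ≡ g i
  descend zero i N≤i = trans (below-f i N≤i) (sym (below-g i N≤i))
  descend (suc k) i N≤ = begin
    f i ≡⟨ Chain-end 0 Ts cf i ⟩
    f (n + i) + landing 0 Ts (n + i) ≡⟨ cong (_+ landing 0 Ts (n + i)) (descend k (n + i) N≤′) ⟩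
    g (n + i) + landing 0 Ts (n + i) ≡⟨ Chain-end 0 Ts cg i ⟨
    g i ∎
    where
    open ≡-Reasoning
    N≤′ : N ≤ k + (n + i)
    N≤′ = ≤-trans N≤ (≤-trans (≤-reflexive (sym (+-suc k i))) (+-monoʳ-≤ k (+-monoˡ-≤ i (>-nonZero⁻¹ n))))

-- Catches modulo the period

-- At most one number `k * n + t` equals `x`, and one does exactly if `x` has remainder `t`; the
-- bound on `x` puts this `k` below `K`.
Σ<-residue : ∀ {n t} .{{_ : NonZero n}} K x → t < n → x < K * n → Σ< K (λ k → δ x (k * n + t)) ≡ δ (x % n) t
Σ<-residue {n} {t} (suc K) x t<n x<Kn with x <? n
... | yes x<n = begin
  δ x t + Σ< K (λ k → δ x (n + k * n + t))
    ≡⟨ cong (δ x t +_) (Σ<-zero K (λ k → δ-≢ x _ (<⇒≢ (<-≤-trans x<n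
         (≤-trans (m≤m+n n (k * n)) (m≤m+n (n + k * n) t)))))) ⟩
  δ x t + 0
    ≡⟨ +-identityʳ _ ⟩
  δ x t
    ≡⟨ cong (λ r → δ r t) (m<n⇒m%n≡m x<n) ⟨
  δ (x % n) t ∎
  where open ≡-Reasoning
... | no x≮n = begin
  δ x t + Σ< K (λ k → δ x (n + k * n + t))
    ≡⟨ cong₂ _+_ (δ-≢ x t (λ { refl → x≮n t<n }))
         (Σ<-cong K (λ k → trans (cong₂ δ x≡ (+-assoc n (k * n) t)) (δ-shift n (x ∸ n) (k * n + t)))) ⟩
  Σ< K (λ k → δ (x ∸ n) (k * n + t))
    ≡⟨ Σ<-residue K (x ∸ n) t<n (+-cancelˡ-< n (x ∸ n) (K * n) (subst (_< n + K * n) x≡ x<Kn)) ⟩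
  δ ((x ∸ n) % n) t
    ≡⟨ cong (λ r → δ r t) ([m+n]%n≡m%n (x ∸ n) n) ⟨
  δ ((x ∸ n + n) % n) t
    ≡⟨ cong (λ y → δ (y % n) t) (m∸n+n≡m (≮⇒≥ x≮n)) ⟩
  δ (x % n) t ∎
  where
  open ≡-Reasoning
  x≡ : x ≡ n + (x ∸ n)
  x≡ = sym (m+[n∸m]≡n (≮⇒≥ x≮n))

length-filter-residue : ∀ {n N t K} .{{_ : NonZero n}} o T → t < n → All (_≤ N) T → o + N < K * n →
  length (filter (λ h → ((o + h) % n) ≟ t) T) ≡ Σ< K (λ k → mult (map (o +_) T) (k * n + t))
length-filter-residue {K = K} o [] _ _ _ = sym (Σ<-zero K (λ _ → refl))
length-filter-residue {n} {N} {t} {K} o (h ∷ T) t<n (h≤N ∷ low) oN<Kn = begin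
  length (filter P? (h ∷ T))
    ≡⟨ first ⟩
  δ ((o + h) % n) t + length (filter P? T)
    ≡⟨ cong₂ _+_ (sym (Σ<-residue K (o + h) t<n (≤-<-trans (+-monoʳ-≤ o h≤N) oN<Kn)))
         (length-filter-residue {K = K} o T t<n low oN<Kn) ⟩
  Σ< K (λ k → δ (o + h) (k * n + t)) + Σ< K (λ k → mult (map (o +_) T) (k * n + t))
    ≡⟨ Σ<-+ K _ _ ⟨
  Σ< K (λ k → mult (map (o +_) (h ∷ T)) (k * n + t)) ∎
  where
  open ≡-Reasoning
  P? : Decidable (λ h → (o + h) % n ≡ t)
  P? h = ((o + h) % n) ≟ t
  first : length (filter P? (h ∷ T)) ≡ δ ((o + h) % n) t + length (filter P? T)
  first = cases (P? h)
    where
    cases : Dec ((o + h) % n ≡ t) → length (filter P? (h ∷ T)) ≡ δ ((o + h) % n) t + length (filter P? T)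
    cases (yes eq) = trans (cong length (List.filter-accept P? eq))
      (cong (_+ length (filter P? T)) (sym (trans (cong (λ r → δ r t) eq) (δ-refl t))))
    cases (no neq) = trans (cong length (List.filter-reject P? neq))
      (cong (_+ length (filter P? T)) (sym (δ-≢ _ t neq)))

-- The number `m` of throws is separate from the modulus `n` because the induction removes throws
-- one at a time. The last hypothesis keeps all landing times below `K * n`.
sum-filter-residue : ∀ {n N t K m} .{{_ : NonZero n}} o (Ts : Vec (List ℕ) m) → t < n → VAll.All (All (_≤ N)) Ts →
  o + (m + N) ≤ K * n →
  sum (map (λ s → length (filter (λ h → ((o + toℕ s + h) % n) ≟ t) (Vec.lookup Ts s))) (allFin m))
    ≡ Σ< K (λ k → landing o Ts (k * n + t))
sum-filter-residue {K = K} o [] _ _ _ = sym (Σ<-zero K (λ _ → refl))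
sum-filter-residue {n} {N} {t} {K} {suc m} o (T ∷ Ts) t<n (low ∷ lows) le = begin
  G (o + 0) T + sum (map (λ s → G (o + toℕ s) (Vec.lookup (T ∷ Ts) s)) (tabulate suc))
    ≡⟨ cong₂ _+_ (cong (λ o → G o T) (+-identityʳ o)) (cong sum (trans
         (List.map-tabulate suc (λ s → G (o + toℕ s) (Vec.lookup (T ∷ Ts) s)))
         (trans (List.tabulate-cong (λ s → cong (λ o → G o (Vec.lookup Ts s)) (+-suc o (toℕ s))))
           (sym (List.map-tabulate (λ s → s) (λ s → G (suc o + toℕ s) (Vec.lookup Ts s))))))) ⟩
  G o T + sum (map (λ s → G (suc o + toℕ s) (Vec.lookup Ts s)) (allFin m))
    ≡⟨ cong₂ _+_ (length-filter-residue {K = K} o T t<n low (≤-trans (s≤s (+-monoʳ-≤ o (m≤n+m N m))) le′))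
         (sum-filter-residue {K = K} (suc o) Ts t<n lows le′) ⟩
  Σ< K (λ k → mult (map (o +_) T) (k * n + t)) + Σ< K (λ k → landing (suc o) Ts (k * n + t))
    ≡⟨ Σ<-+ K _ _ ⟨
  Σ< K (λ k → landing o (T ∷ Ts) (k * n + t)) ∎
  where
  open ≡-Reasoning
  G : ℕ → List ℕ → ℕ
  G o T = length (filter (λ h → ((o + h) % n) ≟ t) T)
  le′ : suc o + (m + N) ≤ K * n
  le′ = subst (_≤ K * n) (+-suc o (m + N)) le

catches≡Σ-landing : ∀ {n N K} .{{_ : NonZero n}} (Ts : Vec (List ℕ) n) → VAll.All (All (_≤ N)) Ts → n + N ≤ K * n →
  ∀ t → catches n Ts t ≡ Σ< K (λ k → landing 0 Ts (k * n + toℕ t))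
catches≡Σ-landing {K = K} Ts lows le t = sum-filter-residue {K = K} 0 Ts (toℕ<n t) lows le

-- The number of balls and the total height

next-below : ∀ {N f} T → All (_≤ N) T → Below N f → Below N (next T f)
next-below T low below i N≤i = cong₂ _+_ (below (suc i) (m≤n⇒m≤1+n N≤i))
  (mult-∉ T (suc i) (All.map (λ h≤N eq → <-irrefl eq (s≤s (≤-trans h≤N N≤i))) low))

Σ<-next : ∀ {N f T} → Pos T → All (_≤ N) T → Below N f → length T ≡ f 0 → Σ< N (next T f) ≡ Σ< N f
Σ<-next {N} {f} {T} pos low below len = begin
  Σ< N (next T f)                                       ≡⟨ Σ<-+ N (f ∘ suc) (mult T ∘ suc) ⟩
  Σ< N (f ∘ suc) + Σ< N (λ i → mult T (suc i))          ≡⟨ cong (Σ< N (f ∘ suc) +_) (trans (Σ<-mult-length pos low) len) ⟩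
  Σ< N (f ∘ suc) + f 0                                  ≡⟨ +-comm _ (f 0) ⟩
  f 0 + Σ< N (f ∘ suc)                                  ≡⟨ Σ<-below-suc below ⟩
  Σ< N f                                                ∎
  where open ≡-Reasoning

-- The total time that the balls of the state still have to fly.
moment : ℕ → (ℕ → ℕ) → ℕ
moment N f = Σ< N (λ i → i * f i)

-- A time step brings every ball in the air one step closer to landing, and a
-- throw of height h adds h.
moment-next : ∀ {N f T} → Pos T → All (_≤ N) T → Below N f → length T ≡ f 0 →
  moment N (next T f) + Σ< N f ≡ moment N f + sum T
moment-next {N} {f} {T} pos low below len = begin
  moment N (next T f) + Σ< N f
    ≡⟨ cong₂ _+_ (trans (Σ<-cong N (λ i → *-distribˡ-+ i (f (suc i)) _)) (Σ<-+ N _ _)) (sym (Σ<-below-suc below)) ⟩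
  (P + Q) + (f 0 + S)
    ≡⟨ cong (λ x → (P + Q) + (x + S)) len ⟨
  (P + Q) + (length T + S)
    ≡⟨ rearrange P Q (length T) S ⟩
  (S + P) + (Q + length T)
    ≡⟨ cong₂ _+_ (trans (sym (Σ<-+ N _ _)) (Σ<-below-suc {N} {λ i → i * f i} below′)) (Σ<-mult-sum pos low) ⟩
  moment N f + sum T ∎
  where
  open ≡-Reasoning
  P = Σ< N (λ i → i * f (suc i))
  Q = Σ< N (λ i → i * mult T (suc i))
  S = Σ< N (f ∘ suc)
  rearrange : ∀ p q l s → (p + q) + (l + s) ≡ (s + p) + (q + l)
  rearrange = solve-∀
  below′ : Below N (λ i → i * f i)
  below′ i N≤i = trans (cong (i *_) (below i N≤i)) (*-zeroʳ i)

moment-chain : ∀ {m N f f′} (Ts : Vec (List ℕ) m) → VAll.All (All (_≤ N)) Ts → Below N f → Chain f Ts f′ →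
  moment N f′ + m * Σ< N f ≡ moment N f + totalHeight Ts
moment-chain {N = N} [] _ _ c = cong (_+ 0) (Σ<-cong N (λ i → cong (i *_) (sym (c i))))
moment-chain {suc m} {N} {f} {f′} (T ∷ Ts) (low ∷ lows) below ((_ , pos) , len , c) = begin
  moment N f′ + (Σ< N f + m * Σ< N f)
    ≡⟨ rearrange (moment N f′) (Σ< N f) (m * Σ< N f) ⟩
  (moment N f′ + m * Σ< N f) + Σ< N f
    ≡⟨ cong (λ x → moment N f′ + m * x + Σ< N f) (Σ<-next pos low below len) ⟨
  (moment N f′ + m * Σ< N (next T f)) + Σ< N f
    ≡⟨ cong (_+ Σ< N f) (moment-chain Ts lows (next-below T low below) c) ⟩
  (moment N (next T f) + totalHeight Ts) + Σ< N f
    ≡⟨ rearrange′ (moment N (next T f)) (totalHeight Ts) (Σ< N f) ⟩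
  (moment N (next T f) + Σ< N f) + totalHeight Ts
    ≡⟨ cong (_+ totalHeight Ts) (moment-next pos low below len) ⟩
  (moment N f + sum T) + totalHeight Ts
    ≡⟨ +-assoc (moment N f) (sum T) _ ⟩
  moment N f + (sum T + totalHeight Ts) ∎
  where
  open ≡-Reasoning
  rearrange : ∀ a b c → a + (b + c) ≡ (a + c) + b
  rearrange = solve-∀
  rearrange′ : ∀ a b c → (a + b) + c ≡ (a + c) + b
  rearrange′ = solve-∀

-- The average theorem: in a closed chain the moments at the two ends cancel.
totalHeight-closed : ∀ {n N f} (Ts : Vec (List ℕ) n) → VAll.All (All (_≤ N)) Ts → Below N f → Chain f Ts f →
  totalHeight Ts ≡ n * Σ< N f
totalHeight-closed {N = N} {f} Ts lows below c = sym (+-cancelˡ-≡ (moment N f) _ _ (moment-chain Ts lows below c))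

heights≤totalHeight : ∀ {m} (Ts : Vec (List ℕ) m) → VAll.All (All (_≤ totalHeight Ts)) Ts
heights≤totalHeight [] = []
heights≤totalHeight (T ∷ Ts) =
  All.map (λ h≤ → ≤-trans h≤ (m≤m+n (sum T) _)) (≤sum T) ∷
  VAll.map (All.map (λ h≤ → ≤-trans h≤ (m≤n+m _ (sum T)))) (heights≤totalHeight Ts)
  where
  ≤sum : ∀ T → All (_≤ sum T) T
  ≤sum [] = []
  ≤sum (h ∷ T) = m≤m+n h (sum T) ∷ All.map (λ h≤ → ≤-trans h≤ (m≤n+m (sum T) h)) (≤sum T)

n+N≤[1+N]*n : ∀ n N .{{_ : NonZero n}} → n + N ≤ suc N * n
n+N≤[1+N]*n n N = +-monoʳ-≤ n (m≤m*n N n)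

-- Siteswaps are the closed chains

chain⇒siteswap : ∀ {n b N f} .{{_ : NonZero n}} (Ts : Vec (List ℕ) n) →
  Below N f → Σ< N f ≡ b → Chain f Ts f → IsMultiplexSiteswap n b Ts
chain⇒siteswap {n} {b} {N} {f} Ts below Σ≡b c = Chain-multisets Ts c , caught , height
  where
  open ≡-Reasoning
  H = totalHeight Ts
  M = N + H
  lows : VAll.All (All (_≤ M)) Ts
  lows = VAll.map (All.map (λ h≤ → ≤-trans h≤ (m≤n+m H N))) (heights≤totalHeight Ts)
  height : H ≡ n * b
  height = trans (totalHeight-closed Ts lows (Below-mono (m≤m+n N H) below) c)
    (cong (n *_) (trans (Σ<-below H below) Σ≡b))
  -- Iterating `Chain-end` over periods pushes the argument of `f` out of its support, so that for
  -- `K = M` only landings remain.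
  unroll : ∀ K i → f i ≡ f (K * n + i) + Σ< K (λ k → landing 0 Ts (suc k * n + i))
  unroll zero i = sym (+-identityʳ _)
  unroll (suc K) i = begin
    f i
      ≡⟨ unroll K i ⟩
    f (K * n + i) + R
      ≡⟨ cong (_+ R) (Chain-end 0 Ts c (K * n + i)) ⟩
    f (n + (K * n + i)) + landing 0 Ts (n + (K * n + i)) + R
      ≡⟨ cong (λ j → f j + landing 0 Ts j + R) (+-assoc n (K * n) i) ⟨
    f (suc K * n + i) + landing 0 Ts (suc K * n + i) + R
      ≡⟨ trans (+-assoc (f (suc K * n + i)) _ R) (cong (f (suc K * n + i) +_) (+-comm _ R)) ⟩
    f (suc K * n + i) + (R + landing 0 Ts (suc K * n + i))
      ≡⟨ cong (f (suc K * n + i) +_) (Σ<-last K _) ⟨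
    f (suc K * n + i) + Σ< (suc K) (λ k → landing 0 Ts (suc k * n + i)) ∎
    where R = Σ< K (λ k → landing 0 Ts (suc k * n + i))
  caught : ∀ t → length (Vec.lookup Ts t) ≡ catches n Ts t
  caught t = begin
    length (Vec.lookup Ts t)
      ≡⟨ Chain-length 0 Ts c t ⟩
    f (toℕ t) + landing 0 Ts (toℕ t)
      ≡⟨ +-comm (f (toℕ t)) _ ⟩
    landing 0 Ts (toℕ t) + f (toℕ t)
      ≡⟨ cong (landing 0 Ts (toℕ t) +_) (trans (unroll M (toℕ t))
           (cong (_+ Σ< M (λ k → landing 0 Ts (suc k * n + toℕ t))) (below _ (≤-trans (m≤m+n N H) (≤-trans (m≤m*n M n) (m≤m+n (M * n) (toℕ t))))))) ⟩
    Σ< (suc M) (λ k → landing 0 Ts (k * n + toℕ t))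
      ≡⟨ catches≡Σ-landing {K = suc M} Ts lows (n+N≤[1+N]*n n M) t ⟨
    catches n Ts t ∎

siteswap⇒chain : ∀ {n b} .{{_ : NonZero n}} (Ts : Vec (List ℕ) n) → IsMultiplexSiteswap n b Ts →
  ∃ λ N → ∃ λ f → VAll.All (All (_≤ N)) Ts × Below N f × Σ< N f ≡ b × Chain f Ts f
siteswap⇒chain {n} {b} Ts (ms , caught , height) = N , f , lows , below , Σ≡b , c
  where
  open ≡-Reasoning
  H = totalHeight Ts
  N = n + H
  -- A ball due `i` steps from now was thrown in some earlier period, on whose clock it lands at
  -- `suc k * n + i`. Landing times are below `n + H`, which is at most `suc H * n`, so the first
  -- `suc H` terms suffice.
  f : ℕ → ℕ
  f i = Σ< (suc H) (λ k → landing 0 Ts (suc k * n + i))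
  lows : VAll.All (All (_≤ N)) Ts
  lows = VAll.map (All.map (λ h≤ → ≤-trans h≤ (m≤n+m H n))) (heights≤totalHeight Ts)
  below : Below N f
  below i N≤i = Σ<-zero (suc H) (λ k → landing-late 0 Ts _ (heights≤totalHeight Ts) (≤-trans N≤i (m≤n+m i (suc k * n))))
  shift : ∀ k i → k * n + (n + i) ≡ n + k * n + i
  shift k i = trans (sym (+-assoc (k * n) n i)) (cong (_+ i) (+-comm (k * n) n))
  end : ∀ i → f i ≡ f (n + i) + landing 0 Ts (n + i)
  end i = begin
    f i
      ≡⟨ +-identityʳ (f i) ⟨
    f i + 0
      ≡⟨ cong (f i +_) (landing-late 0 Ts (suc (suc H) * n + i) (heights≤totalHeight Ts)
           (≤-trans (n+N≤[1+N]*n n H) (≤-trans (m≤n+m (suc H * n) n) (m≤m+n _ i)))) ⟨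
    f i + landing 0 Ts (suc (suc H) * n + i)
      ≡⟨ Σ<-last (suc H) (λ k → landing 0 Ts (suc k * n + i)) ⟨
    landing 0 Ts (n + 0 + i) + Σ< (suc H) (λ k → landing 0 Ts (suc (suc k) * n + i))
      ≡⟨ cong₂ _+_ (cong (λ j → landing 0 Ts (j + i)) (+-identityʳ n))
           (Σ<-cong (suc H) (λ k → cong (landing 0 Ts) (sym (shift (suc k) i)))) ⟩
    landing 0 Ts (n + i) + f (n + i)
      ≡⟨ +-comm _ (f (n + i)) ⟩
    f (n + i) + landing 0 Ts (n + i) ∎
  len : ∀ t → length (Vec.lookup Ts t) ≡ f (toℕ t) + landing 0 Ts (toℕ t)
  len t = begin
    length (Vec.lookup Ts t)
      ≡⟨ caught t ⟩
    catches n Ts t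
      -- One term more than in `f`: the landings within the period of the throw itself.
      ≡⟨ catches≡Σ-landing {K = suc (suc H)} Ts (heights≤totalHeight Ts)
           (≤-trans (n+N≤[1+N]*n n H) (m≤n+m (suc H * n) n)) t ⟩
    landing 0 Ts (toℕ t) + f (toℕ t)
      ≡⟨ +-comm _ (f (toℕ t)) ⟩
    f (toℕ t) + landing 0 Ts (toℕ t) ∎
  c : Chain f Ts f
  c = Chain-intro 0 Ts ms len end
  Σ≡b : Σ< N f ≡ b
  Σ≡b = *-cancelˡ-≡ (Σ< N f) b n (trans (sym (totalHeight-closed Ts lows below c)) height)

-- Multisets with prescribed multiplicities

mult-++ : ∀ S T u → mult (S ++ T) u ≡ mult S u + mult T u
mult-++ [] T u = refl
mult-++ (h ∷ S) T u = trans (cong (δ h u +_) (mult-++ S T u)) (sym (+-assoc (δ h u) _ _))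

mult-replicate : ∀ c h u → mult (replicate c h) u ≡ c * δ h u
mult-replicate zero h u = refl
mult-replicate (suc c) h u = cong (δ h u +_) (mult-replicate c h u)

-- Realises the multiplicity `m i` at `h + i`. Increasing values make the list the canonical
-- representative of its multiset.
spread : ℕ → ℕ → (ℕ → ℕ) → List ℕ
spread h zero m = []
spread h (suc N) m = replicate (m 0) h ++ spread (suc h) N (m ∘ suc)

spread-≥ : ∀ h N m → All (h ≤_) (spread h N m)
spread-≥ h zero m = []
spread-≥ h (suc N) m = All.++⁺ (All.replicate⁺ (m 0) ≤-refl) (All.map <⇒≤ (spread-≥ (suc h) N (m ∘ suc)))

linked-∷ : ∀ {h T} → All (h ≤_) T → Linked _≤_ T → Linked _≤_ (h ∷ T)
linked-∷ [] [] = [-]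
linked-∷ (h≤ ∷ _) linked@[-] = h≤ ∷ linked
linked-∷ (h≤ ∷ _) linked@(_ ∷ _) = h≤ ∷ linked

spread-linked : ∀ h N m → Linked _≤_ (spread h N m)
spread-linked h zero m = []
spread-linked h (suc N) m = block (m 0)
  where
  rest = spread (suc h) N (m ∘ suc)
  block : ∀ c → Linked _≤_ (replicate c h ++ rest)
  block zero = spread-linked (suc h) N (m ∘ suc)
  block (suc c) = linked-∷
    (All.++⁺ (All.replicate⁺ c ≤-refl) (All.map <⇒≤ (spread-≥ (suc h) N (m ∘ suc)))) (block c)

length-spread : ∀ h N m → length (spread h N m) ≡ Σ< N m
length-spread h zero m = refl
length-spread h (suc N) m = trans (List.length-++ (replicate (m 0) h))
  (cong₂ _+_ (List.length-replicate (m 0)) (length-spread (suc h) N (m ∘ suc)))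

mult-spread : ∀ h N m → Below N m → ∀ i → mult (spread h N m) (h + i) ≡ m i
mult-spread h zero m below i = sym (below i z≤n)
mult-spread h (suc N) m below i = begin
  mult (replicate (m 0) h ++ rest) (h + i)
    ≡⟨ mult-++ (replicate (m 0) h) rest (h + i) ⟩
  mult (replicate (m 0) h) (h + i) + mult rest (h + i)
    ≡⟨ cong (_+ mult rest (h + i)) (mult-replicate (m 0) h (h + i)) ⟩
  m 0 * δ h (h + i) + mult rest (h + i)
    ≡⟨ cases i ⟩
  m i ∎
  where
  open ≡-Reasoning
  rest = spread (suc h) N (m ∘ suc)
  cases : ∀ i → m 0 * δ h (h + i) + mult rest (h + i) ≡ m i
  cases zero = begin
    m 0 * δ h (h + 0) + mult rest (h + 0)
      ≡⟨ cong (λ u → m 0 * δ h u + mult rest u) (+-identityʳ h) ⟩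
    m 0 * δ h h + mult rest h
      ≡⟨ cong₂ _+_ (trans (cong (m 0 *_) (δ-refl h)) (*-identityʳ (m 0)))
           (mult-∉ rest h (All.map (λ h< eq → <-irrefl (sym eq) h<) (spread-≥ (suc h) N (m ∘ suc)))) ⟩
    m 0 + 0
      ≡⟨ +-identityʳ (m 0) ⟩
    m 0 ∎
  cases (suc i) = cong₂ _+_
    (trans (cong (m 0 *_) (δ-≢ h _ (<⇒≢ (m<m+n h z<s)))) (*-zeroʳ (m 0)))
    (trans (cong (mult rest) (+-suc h i)) (mult-spread (suc h) N (m ∘ suc) (λ j N≤j → below (suc j) (s≤s N≤j)) i))

mult-head : ∀ h T → mult (h ∷ T) h ≡ suc (mult T h)
mult-head h T = cong (_+ mult T h) (δ-refl h)

linked⇒≥head : ∀ {h T} → Linked _≤_ (h ∷ T) → All (h ≤_) T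
linked⇒≥head l with Linked⇒AllPairs ≤-trans l
... | h≤ ∷ _ = h≤

head-minimal : ∀ {h h′ T} → Linked _≤_ (h′ ∷ T) → h < h′ → mult (h′ ∷ T) h ≡ 0
head-minimal {h} {h′} {T} l h<h′ = mult-∉ (h′ ∷ T) h
  ((λ eq → <-irrefl (sym eq) h<h′) ∷ All.map (λ h′≤ eq → <-irrefl (sym eq) (<-≤-trans h<h′ h′≤)) (linked⇒≥head l))

-- If the heads differ, the smaller one does not occur in the other list at all.
sorted-unique : ∀ {S T} → Linked _≤_ S → Linked _≤_ T → (∀ u → mult S u ≡ mult T u) → S ≡ T
sorted-unique {[]} {[]} _ _ eq = refl
sorted-unique {[]} {h ∷ T} _ _ eq = contradiction (trans (eq h) (mult-head h T)) 0≢1+n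
sorted-unique {h ∷ S} {[]} _ _ eq = contradiction (trans (sym (eq h)) (mult-head h S)) 0≢1+n
sorted-unique {h ∷ S} {h′ ∷ T} l l′ eq with <-cmp h h′
... | tri< h<h′ _ _ = contradiction (trans (sym (head-minimal l′ h<h′)) (trans (sym (eq h)) (mult-head h S))) 0≢1+n
... | tri> _ _ h′<h = contradiction (trans (sym (head-minimal l h′<h)) (trans (eq h′) (mult-head h′ T))) 0≢1+n
... | tri≈ _ refl _ =
  cong (h ∷_) (sorted-unique (Linked.tail l) (Linked.tail l′) (λ u → +-cancelˡ-≡ (δ h u) _ _ (eq u)))

multiset-unique : ∀ {S T} → IsMultiset⁺ S → IsMultiset⁺ T → (∀ i → mult S (suc i) ≡ mult T (suc i)) → S ≡ T
multiset-unique {S} {T} (l , pos) (l′ , pos′) eq = sorted-unique l l′ eq′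
  where
  no-zero : ∀ {T} → Pos T → mult T 0 ≡ 0
  no-zero pos = mult-∉ _ 0 (All.map (λ { (s≤s _) () }) pos)
  eq′ : ∀ u → mult S u ≡ mult T u
  eq′ zero = trans (no-zero pos) (sym (no-zero pos′))
  eq′ (suc i) = eq i

-- States as groups with gaps

-- The groups q and the gaps g encode the state in which d₁ empty time steps
-- precede the landing of the first group, d₂ more precede the second one, ….
ev : List ℕ → List ℕ → ℕ → ℕ
ev [] _ _ = 0
ev (_ ∷ _) [] _ = 0
ev (x ∷ q) (zero ∷ g) zero = x
ev (x ∷ q) (zero ∷ g) (suc i) = ev q g i
ev (x ∷ q) (suc d ∷ g) zero = 0
ev (x ∷ q) (suc d ∷ g) (suc i) = ev (x ∷ q) (d ∷ g) i

-- A group of size 0 would be invisible to `ev`, so positivity is what makes the encoding unique;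
-- the gaps are arbitrary.
data State : List ℕ → List ℕ → Set where
  []  : State [] []
  _∷_ : ∀ {x d q g} → 1 ≤ x → State q g → State (x ∷ q) (d ∷ g)

State-length : ∀ {q g} → State q g → length g ≡ length q
State-length [] = refl
State-length (_ ∷ s) = cong suc (State-length s)

State-zeros : ∀ {q} → Pos q → State q (map (λ _ → 0) q)
State-zeros [] = []
State-zeros (p ∷ pos) = p ∷ State-zeros pos

State-pos : ∀ {q g} → State q g → Pos q
State-pos [] = []
State-pos (p ∷ s) = p ∷ State-pos s

delay : ℕ → List ℕ → List ℕ
-- Empty time after the last group is not recorded.
delay k [] = []
delay k (d ∷ g) = k + d ∷ g

delay-zero : ∀ g → delay 0 g ≡ g
delay-zero [] = refl
delay-zero (d ∷ g) = refl

State-delay : ∀ {q g} k → State q g → State q (delay k g)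
State-delay k [] = []
State-delay k (p ∷ s) = p ∷ s

ev-delay-zero : ∀ q g k → ev q (delay (suc k) g) 0 ≡ 0
ev-delay-zero [] g k = refl
ev-delay-zero (x ∷ q) [] k = refl
ev-delay-zero (x ∷ q) (d ∷ g) k = refl

ev-delay-suc : ∀ q g k i → ev q (delay (suc k) g) (suc i) ≡ ev q (delay k g) i
ev-delay-suc [] g k i = refl
ev-delay-suc (x ∷ q) [] k i = refl
ev-delay-suc (x ∷ q) (d ∷ g) k i = refl

ev-at : ∀ x q d g → ev (x ∷ q) (d ∷ g) d ≡ x
ev-at x q zero g = refl
ev-at x q (suc d) g = ev-at x q d g

ev-before : ∀ x q {d} g {i} → i < d → ev (x ∷ q) (d ∷ g) i ≡ 0
ev-before x q g {zero} (s≤s _) = refl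
ev-before x q g {suc i} (s≤s i<d) = ev-before x q g i<d

ev-after : ∀ x q d g i → ev (x ∷ q) (d ∷ g) (suc d + i) ≡ ev q g i
ev-after x q zero g i = refl
ev-after x q (suc d) g i = ev-after x q d g i

ev-later : ∀ x q k d g i → ev (x ∷ q) (k + d ∷ g) (k + i) ≡ ev (x ∷ q) (d ∷ g) i
ev-later x q zero d g i = refl
ev-later x q (suc k) d g i = ev-later x q k d g i

-- The first nonzero value reveals the first gap and the first group.
ev-injective : ∀ {q g q′ g′} → State q g → State q′ g′ → (∀ i → ev q g i ≡ ev q′ g′ i) → q ≡ q′ × g ≡ g′
ev-injective [] [] eq = refl , refl
ev-injective [] (_∷_ {x} {d} {q} {g} 1≤x s) eq =
  contradiction (trans (eq d) (ev-at x q d g)) (<⇒≢ 1≤x)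
ev-injective (_∷_ {x} {d} {q} {g} 1≤x s) [] eq =
  contradiction (trans (sym (eq d)) (ev-at x q d g)) (<⇒≢ 1≤x)
ev-injective (_∷_ {x} {d} {q} {g} 1≤x s) (_∷_ {x′} {d′} {q′} {g′} 1≤x′ s′) eq with <-cmp d d′
... | tri< d<d′ _ _ = contradiction
  (trans (sym (ev-before x′ q′ g′ d<d′)) (trans (sym (eq d)) (ev-at x q d g))) (<⇒≢ 1≤x)
... | tri> _ _ d′<d = contradiction
  (trans (sym (ev-before x q g d′<d)) (trans (eq d′) (ev-at x′ q′ d′ g′))) (<⇒≢ 1≤x′)
... | tri≈ _ refl _ with ev-injective s s′
      (λ i → trans (sym (ev-after x q d g i)) (trans (eq (suc d + i)) (ev-after x′ q′ d g′ i)))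
...   | refl , refl = cong (_∷ q) (trans (sym (ev-at x q d g)) (trans (eq d) (ev-at x′ q d g))) , refl

encode : ∀ N f → Below N f → ∃₂ λ q g → State q g × (∀ i → ev q g i ≡ f i) × sum q ≡ Σ< N f
encode zero f below = [] , [] , [] , (λ i → sym (below i z≤n)) , refl
encode (suc N) f below with encode N (f ∘ suc) (λ i N≤i → below (suc i) (s≤s N≤i)) | f 0 in f0
... | q , g , s , eq , sum≡ | zero = q , delay 1 g , State-delay 1 s , eq′ , sum≡
  where
  eq′ : ∀ i → ev q (delay 1 g) i ≡ f i
  eq′ zero = trans (ev-delay-zero q g 0) (sym f0)
  eq′ (suc i) = trans (ev-delay-suc q g 0 i) (trans (cong (λ g → ev q g i) (delay-zero g)) (eq i))
... | q , g , s , eq , sum≡ | suc y = suc y ∷ q , 0 ∷ g , s≤s z≤n ∷ s , eq′ , cong (suc y +_) sum≡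
  where
  eq′ : ∀ i → ev (suc y ∷ q) (0 ∷ g) i ≡ f i
  eq′ zero = sym f0
  eq′ (suc i) = eq i

-- One more than the landing time of the last group, and 0 if there is none.
span : List ℕ → ℕ
span [] = 0
span (d ∷ g) = suc (d + span g)

ev-below : ∀ q g → Below (span g) (ev q g)
ev-below [] g i _ = refl
ev-below (x ∷ q) [] i _ = refl
ev-below (x ∷ q) (zero ∷ g) (suc i) (s≤s le) = ev-below q g i le
ev-below (x ∷ q) (suc d ∷ g) (suc i) (s≤s le) = ev-below (x ∷ q) (d ∷ g) i le

Σ<-ev-span : ∀ {q g} → State q g → Σ< (span g) (ev q g) ≡ sum q
Σ<-ev-span [] = refl
Σ<-ev-span (_∷_ {x} {d} {q} {g} _ s) = from d
  where
  from : ∀ d → Σ< (span (d ∷ g)) (ev (x ∷ q) (d ∷ g)) ≡ x + sum q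
  from zero = cong (x +_) (Σ<-ev-span s)
  from (suc d) = from d

Σ<-ev : ∀ {q g} M → State q g → Below M (ev q g) → Σ< M (ev q g) ≡ sum q
Σ<-ev {q} {g} M s below = begin
  Σ< M (ev q g)            ≡⟨ Σ<-below (span g) below ⟨
  Σ< (M + span g) (ev q g) ≡⟨ cong (λ N → Σ< N (ev q g)) (+-comm M (span g)) ⟩
  Σ< (span g + M) (ev q g) ≡⟨ Σ<-below M (ev-below q g) ⟩
  Σ< (span g) (ev q g)     ≡⟨ Σ<-ev-span s ⟩
  sum q                    ∎
  where open ≡-Reasoning

-- Gaps are transported backwards along cards

-- A selected group keeps its landing time. The `d` empty steps of a skipped group and its own
-- landing step become empty time before the next selected group, hence `suc d`.
lift : List Bool → List ℕ → List ℕ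
lift [] _ = []
lift (_ ∷ _) [] = []
lift (true ∷ bs) (d ∷ g) = d ∷ lift bs g
lift (false ∷ bs) (d ∷ g) = delay (suc d) (lift bs g)

-- On a throw the first group lands now, with gap 0. The gaps behind it are counted from the
-- following step, which is the time origin of `g`, so they need no shift.
liftCard : Card → List ℕ → List ℕ
liftCard nothing g = delay 1 g
liftCard (just bs) g = 0 ∷ lift bs g

State-lift : ∀ {xs ys bs g} → IsEmb xs ys bs → Pos xs → State ys g → State xs (lift bs g)
State-lift [] [] [] = []
State-lift (take _ e) (p ∷ pos) (_ ∷ s) = p ∷ State-lift e pos s
State-lift (skip e) pos (_ ∷ s) = State-delay _ (State-lift e pos s)

State-liftCard : ∀ {q c r g} → IsCard q c r → Pos q → State r g → State q (liftCard c g)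
State-liftCard wait pos s = State-delay 1 s
State-liftCard (throw e) (p ∷ pos) s = p ∷ State-lift e pos s

ev-lift-≤ : ∀ {xs ys bs g} → IsEmb xs ys bs → State ys g → ∀ i → ev xs (lift bs g) i ≤ ev ys g i
ev-lift-≤ [] [] i = z≤n
ev-lift-≤ (take {x} {y} {xs} {ys} {bs} x≤y e) (_∷_ {d = d} {g = g} _ s) = go d
  where
  go : ∀ d i → ev (x ∷ xs) (d ∷ lift bs g) i ≤ ev (y ∷ ys) (d ∷ g) i
  go zero zero = x≤y
  go zero (suc i) = ev-lift-≤ e s i
  go (suc d) zero = z≤n
  go (suc d) (suc i) = go d i
ev-lift-≤ (skip {y} {xs} {ys} {bs} e) (_∷_ {d = d} {g = g} _ s) = go d
  where
  open ≤-Reasoning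
  go : ∀ d i → ev xs (delay (suc d) (lift bs g)) i ≤ ev (y ∷ ys) (d ∷ g) i
  go d zero = ≤-trans (≤-reflexive (ev-delay-zero xs (lift bs g) d)) z≤n
  go zero (suc i) = begin
    ev xs (delay 1 (lift bs g)) (suc i) ≡⟨ ev-delay-suc xs (lift bs g) 0 i ⟩
    ev xs (delay 0 (lift bs g)) i       ≡⟨ cong (λ g → ev xs g i) (delay-zero (lift bs g)) ⟩
    ev xs (lift bs g) i                 ≤⟨ ev-lift-≤ e s i ⟩
    ev ys g i                           ∎
  go (suc d) (suc i) = begin
    ev xs (delay (suc (suc d)) (lift bs g)) (suc i) ≡⟨ ev-delay-suc xs (lift bs g) (suc d) i ⟩
    ev xs (delay (suc d) (lift bs g)) i             ≤⟨ go d i ⟩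
    ev (y ∷ ys) (d ∷ g) i                           ∎

-- Compare the first landing times: `xs` cannot land first, a tie selects the group of `ys`, and
-- otherwise that group is skipped and the gap of `xs` shortened by `suc e`.
ev-≤⇒lift : ∀ {xs a ys b} → State xs a → State ys b → (∀ i → ev xs a i ≤ ev ys b i) →
  ∃ λ bs → IsEmb xs ys bs × lift bs b ≡ a
ev-≤⇒lift [] [] le = [] , [] , refl
ev-≤⇒lift (_∷_ {x} {d} {xs} {a} 1≤x s) [] le =
  contradiction (≤-trans 1≤x (subst (_≤ 0) (ev-at x xs d a) (le d))) λ ()
ev-≤⇒lift [] (_ ∷ s′) le with ev-≤⇒lift [] s′ (λ _ → z≤n)
... | bs , e , eq = false ∷ bs , skip e , cong (delay _) eq
ev-≤⇒lift sx@(_∷_ {x} {d} {xs} {a} 1≤x s) (_∷_ {y} {e} {ys} {b} 1≤y s′) le with <-cmp d e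
... | tri< d<e _ _ =
  contradiction (≤-trans 1≤x (subst₂ _≤_ (ev-at x xs d a) (ev-before y ys b d<e) (le d))) λ ()
... | tri≈ _ refl _ with ev-≤⇒lift s s′ (λ i → subst₂ _≤_ (ev-after x xs d a i) (ev-after y ys d b i) (le (suc d + i)))
...   | bs , emb , eq =
  true ∷ bs , take (subst₂ _≤_ (ev-at x xs d a) (ev-at y ys d b) (le d)) emb , cong (d ∷_) eq
ev-≤⇒lift (_∷_ {x} {d} {xs} {a} 1≤x s) (_∷_ {y} {e} {ys} {b} 1≤y s′) le | tri> _ _ e<d
  with ev-≤⇒lift (_∷_ {d = d ∸ suc e} 1≤x s) s′ (λ i → subst₂ _≤_
    (trans (cong (λ d → ev (x ∷ xs) (d ∷ a) (suc e + i)) (sym (m+[n∸m]≡n e<d))) (ev-later x xs (suc e) (d ∸ suc e) a i))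
    (ev-after y ys e b i) (le (suc e + i)))
...   | bs , emb , eq = false ∷ bs , skip emb , trans (cong (delay (suc e)) eq) (cong (_∷ a) (m+[n∸m]≡n e<d))

-- Selecting a group leaves first gap `d`, skipping it a larger one; this lets `lift-injective` read
-- off the mask.
∷-delay-≢ : ∀ {x xs d g g′} → State (x ∷ xs) g′ → d ∷ g ≢ delay (suc d) g′
∷-delay-≢ {d = d} (_∷_ {d = d′} _ _) eq = m≢1+m+n d (List.∷-injectiveˡ eq)

delay-injective : ∀ k g g′ → delay k g ≡ delay k g′ → g ≡ g′
delay-injective k [] [] eq = refl
delay-injective k (d ∷ g) (d′ ∷ g′) eq =
  cong₂ _∷_ (+-cancelˡ-≡ k d d′ (List.∷-injectiveˡ eq)) (List.∷-injectiveʳ eq)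

lift-injective : ∀ {xs ys bs bs′ g} → IsEmb xs ys bs → IsEmb xs ys bs′ → Pos xs → State ys g →
  lift bs g ≡ lift bs′ g → bs ≡ bs′
lift-injective [] [] pos s eq = refl
lift-injective (take _ e) (take _ e′) (_ ∷ pos) (_ ∷ s) eq =
  cong (true ∷_) (lift-injective e e′ pos s (List.∷-injectiveʳ eq))
lift-injective (take _ e) (skip e′) pos (_ ∷ s) eq = contradiction eq (∷-delay-≢ (State-lift e′ pos s))
lift-injective (skip e) (take _ e′) pos (_ ∷ s) eq = contradiction (sym eq) (∷-delay-≢ (State-lift e pos s))
lift-injective (skip e) (skip e′) pos (_ ∷ s) eq =
  cong (false ∷_) (lift-injective e e′ pos s (delay-injective _ _ _ eq))

liftCard-injective : ∀ {q c c′ r g} → IsCard q c r → IsCard q c′ r → State r g →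
  Pos q → liftCard c g ≡ liftCard c′ g → c ≡ c′
liftCard-injective wait wait s pos eq = refl
liftCard-injective wait (throw e) (_ ∷ s) pos ()
liftCard-injective (throw e) wait (_ ∷ s) pos ()
liftCard-injective (throw e) (throw e′) s (_ ∷ pos) eq =
  cong just (lift-injective e e′ pos s (List.∷-injectiveʳ eq))

-- Walks with gaps and chains of states

-- The balls of the next state that were not already in the air. Position `i` there is `suc i` steps
-- from now, so heights start at 1.
throwOf : List ℕ → List ℕ → List ℕ → List ℕ → List ℕ
throwOf q g r g′ = spread 1 (span g′) (λ i → ev r g′ i ∸ ev q g (suc i))

ev-liftCard-≤ : ∀ {q c r g} → IsCard q c r → State r g → ∀ i → ev q (liftCard c g) (suc i) ≤ ev r g i
ev-liftCard-≤ {q} {g = g} wait s i =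
  ≤-reflexive (trans (ev-delay-suc q g 0 i) (cong (λ g → ev q g i) (delay-zero g)))
ev-liftCard-≤ (throw e) s i = ev-lift-≤ e s i

mult-throwOf : ∀ q g r g′ i → mult (throwOf q g r g′) (suc i) ≡ ev r g′ i ∸ ev q g (suc i)
mult-throwOf q g r g′ = mult-spread 1 (span g′) _ λ i le →
  trans (cong (_∸ ev q g (suc i)) (ev-below r g′ i le)) (0∸n≡0 (ev q g (suc i)))

throwOf-multiset : ∀ q g r g′ → IsMultiset⁺ (throwOf q g r g′)
throwOf-multiset q g r g′ = spread-linked 1 (span g′) _ , spread-≥ 1 (span g′) _

next-throwOf : ∀ q g r g′ → (∀ i → ev q g (suc i) ≤ ev r g′ i) →
  ∀ i → next (throwOf q g r g′) (ev q g) i ≡ ev r g′ i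
next-throwOf q g r g′ le i =
  trans (cong (ev q g (suc i) +_) (mult-throwOf q g r g′ i)) (m+[n∸m]≡n (le i))

-- Both states hold equally many balls, and those landing now are the only ones not carried over.
length-throwOf : ∀ {q g r g′} → State q g → State r g′ → sum q ≡ sum r → (∀ i → ev q g (suc i) ≤ ev r g′ i) →
  length (throwOf q g r g′) ≡ ev q g 0
length-throwOf {q} {g} {r} {g′} s s′ q≡r le = trans (length-spread 1 N m) (+-cancelʳ-≡ (Σ< N (ev q g ∘ suc)) _ _ (begin
  Σ< N m + Σ< N (ev q g ∘ suc)             ≡⟨ Σ<-+ N m (ev q g ∘ suc) ⟨
  Σ< N (λ i → m i + ev q g (suc i))        ≡⟨ Σ<-cong N (λ i → m∸n+n≡m (le i)) ⟩
  Σ< N (ev r g′)                           ≡⟨ Σ<-ev-span s′ ⟩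
  sum r                                    ≡⟨ q≡r ⟨
  sum q                                    ≡⟨ Σ<-ev (suc N) s below ⟨
  ev q g 0 + Σ< N (ev q g ∘ suc)           ∎))
  where
  open ≡-Reasoning
  N = span g′
  m : ℕ → ℕ
  m i = ev r g′ i ∸ ev q g (suc i)
  below : Below (suc N) (ev q g)
  below (suc i) (s≤s N≤i) = n≤0⇒n≡0 (≤-trans (le i) (≤-reflexive (ev-below r g′ i N≤i)))

back : ∀ {n} → Vec Step n → List ℕ → List ℕ
back [] g = g
back ((c , _) ∷ st) g = liftCard c (back st g)

throwsAlong : ∀ {n} → List ℕ → Vec Step n → List ℕ → Vec (List ℕ) n
throwsAlong q [] g = []
throwsAlong q ((c , r) ∷ st) g =
  throwOf q (liftCard c (back st g)) r (back st g) ∷ throwsAlong r st g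

State-back : ∀ {n b q q′ g} (st : Vec Step n) → IsWalk b q st q′ → Pos q → State q′ g → State q (back st g)
State-back [] refl pos s = s
State-back (_ ∷ st) ((pos′ , _) , card , w) pos s = State-liftCard card pos (State-back st w pos′ s)

walk⇒chain : ∀ {n b q q′ g} (st : Vec Step n) → IsWalk b q st q′ → IsComp b q → State q′ g →
  Chain (ev q (back st g)) (throwsAlong q st g) (ev q′ g)
walk⇒chain [] refl comp s i = refl
walk⇒chain {q = q} {g = g} ((c , r) ∷ st) (comp′ , card , w) comp s =
  throwOf-multiset q (back ((c , r) ∷ st) g) r (back st g) ,
  length-throwOf (State-liftCard card (proj₁ comp) s′) s′ (trans (proj₂ comp) (sym (proj₂ comp′))) le ,
  Chain-congˡ (throwsAlong r st g) (λ i → sym (next-throwOf q (liftCard c (back st g)) r (back st g) le i)) (walk⇒chain st w comp′ s)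
  where
  s′ : State r (back st g)
  s′ = State-back st w (proj₁ comp′) s
  le : ∀ i → ev q (liftCard c (back st g)) (suc i) ≤ ev r (back st g) i
  le = ev-liftCard-≤ card s′

-- The first gap decides: 0 means that a group lands and the card is a throw. Otherwise nothing
-- lands and the state merely advances, so uniqueness of the encoding yields a wait.
step⇒card : ∀ {q g r g′} → State q g → State r g′ → (∀ i → ev q g (suc i) ≤ ev r g′ i) →
  (ev q g 0 ≡ 0 → ∀ i → ev q g (suc i) ≡ ev r g′ i) → ∃ λ c → IsCard q c r × liftCard c g′ ≡ g
step⇒card [] s′ le eq with ev-injective [] s′ (eq refl)
... | refl , refl = nothing , wait , refl
step⇒card (_∷_ {d = zero} p s) s′ le eq with ev-≤⇒lift s s′ le
... | bs , e , refl = just bs , throw e , refl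
step⇒card (_∷_ {d = suc d} p s) s′ le eq with ev-injective (_∷_ {d = d} p s) s′ (eq refl)
... | refl , refl = nothing , wait , refl

chain⇒walk : ∀ {m N b q g q′ g′} (Ts : Vec (List ℕ) m) → VAll.All (All (_≤ N)) Ts →
  State q g → State q′ g′ → Below N (ev q g) → sum q ≡ b → Chain (ev q g) Ts (ev q′ g′) →
  ∃ λ st → IsWalk b q st q′ × back st g′ ≡ g × throwsAlong q st g′ ≡ Ts
chain⇒walk [] _ s s′ below sum≡ c with ev-injective s s′ c
... | refl , refl = [] , refl , refl , refl
chain⇒walk {N = N} {b} {q} {g} {q′} {g′} (T ∷ Ts) (low ∷ lows) s s′ below sum≡ (ms , len , c)
  with encode N (next T (ev q g)) (next-below T low below)
... | r , gr , sr , ev≡ , sumr with step⇒card s sr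
        (λ i → subst (ev q g (suc i) ≤_) (sym (ev≡ i)) (m≤m+n _ (mult T (suc i))))
        -- When nothing lands, `T` is empty and `next` only shifts the state.
        (λ eq i → sym (trans (ev≡ i) (trans (cong (λ T → ev q g (suc i) + mult T (suc i))
          (length-zero T (trans len eq))) (+-identityʳ _))))
  where
  length-zero : ∀ (T : List ℕ) → length T ≡ 0 → T ≡ []
  length-zero [] _ = refl
...   | cd , card , lift≡
        with trans sumr (trans (Σ<-next (proj₂ ms) low below len) (trans (Σ<-ev N s below) sum≡))
...     | sumr≡b
          with chain⇒walk Ts lows sr s′ (λ i N≤i → trans (ev≡ i) (next-below T low below i N≤i))
                 sumr≡b (Chain-congˡ Ts (λ i → sym (ev≡ i)) c)
...       | st , w , refl , refl =
  (cd , r) ∷ st , ((State-pos sr , sumr≡b) , card , w) , lift≡ ,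
  cong (_∷ throwsAlong r st g′) (trans (cong (λ g → throwOf q g r gr) lift≡)
    (multiset-unique (throwOf-multiset q g r gr) ms λ i →
      trans (mult-throwOf q g r gr i) (trans (cong (_∸ ev q g (suc i)) (ev≡ i)) (m+n∸m≡n (ev q g (suc i)) _))))

-- Read forwards: gaps and throw determine the next state, hence its groups and gaps, and the gaps
-- on both sides of a card determine the card.
walk-unique : ∀ {n b q q′ g} (st st′ : Vec Step n) → IsWalk b q st q′ → IsWalk b q st′ q′ → IsComp b q → State q′ g →
  back st g ≡ back st′ g → throwsAlong q st g ≡ throwsAlong q st′ g → st ≡ st′
walk-unique [] [] _ _ _ _ _ _ = refl
walk-unique {q = q} {g = g} ((c , r) ∷ st) ((c′ , r′) ∷ st′) (comp , card , w) (comp′ , card′ , w′) compq s back≡ throws≡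
  with ev-injective (State-back st w (proj₁ comp) s) (State-back st′ w′ (proj₁ comp′) s) same
  where
  same : ∀ i → ev r (back st g) i ≡ ev r′ (back st′ g) i
  same i = begin
    ev r (back st g) i
      ≡⟨ next-throwOf q _ r (back st g) (ev-liftCard-≤ card (State-back st w (proj₁ comp) s)) i ⟨
    next (throwOf q (liftCard c (back st g)) r (back st g)) (ev q (liftCard c (back st g))) i
      ≡⟨ cong₂ (λ T g → next T (ev q g) i) (Vec.∷-injectiveˡ throws≡) back≡ ⟩
    next (throwOf q (liftCard c′ (back st′ g)) r′ (back st′ g)) (ev q (liftCard c′ (back st′ g))) i
      ≡⟨ next-throwOf q _ r′ (back st′ g) (ev-liftCard-≤ card′ (State-back st′ w′ (proj₁ comp′) s)) i ⟩
    ev r′ (back st′ g) i ∎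
    where open ≡-Reasoning
... | refl , gaps≡
  with liftCard-injective card card′ (State-back st w (proj₁ comp) s) (proj₁ compq)
         (trans back≡ (cong (liftCard c′) (sym gaps≡)))
... | refl = cong ((c , r) ∷_) (walk-unique st st′ w w′ comp s gaps≡ (Vec.∷-injectiveʳ throws≡))

-- Fixed points of the backward transport of gaps

span-delay : ∀ k d g → span (delay k (d ∷ g)) ≡ k + span (d ∷ g)
span-delay k d g = trans (cong suc (+-assoc k d (span g))) (sym (+-suc k (d + span g)))

-- Skipped time is added to the next selected gap; as the last group is selected, such a gap always
-- follows and no time is lost.
span-lift : ∀ {xs ys bs g} → IsEmb xs ys bs → State ys g → lastTrue bs ≡ true → span (lift bs g) ≡ span g
span-lift {bs = _ ∷ bs} (take p e) (_∷_ {d = d} _ s) eq with lastTrue-∷⁻ true bs eq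
span-lift (take p []) (_ ∷ []) eq | inj₁ _ = refl
... | inj₂ eq′ = cong (λ n → suc (d + n)) (span-lift e s eq′)
span-lift {bs = _ ∷ bs} (skip e) (_∷_ {d = d} {g = g} _ s) eq with lastTrue-∷⁻ false bs eq
... | inj₂ eq′ with lift bs g | span-lift e s eq′
...   | d′ ∷ g′ | span≡ = trans (span-delay (suc d) d′ g′) (cong (suc d +_) span≡)
span-lift (skip (take _ _)) (_ ∷ (_ ∷ _)) eq | inj₂ _ | [] | ()
span-lift (skip (skip _)) (_ ∷ (_ ∷ _)) eq | inj₂ _ | [] | ()

span-liftCard : ∀ {q c r g} → IsCard q c r → State r g → keepsTop q c ≡ true → span (liftCard c g) ≡ suc (span g)
span-liftCard wait (_ ∷ _) eq = refl
span-liftCard (throw e) s eq = cong suc (span-lift e s eq)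

span-back : ∀ {n b q q′ g} (st : Vec Step n) → IsWalk b q st q′ → State q′ g → keepsTopAlong q st ≡ true →
  span (back st g) ≡ n + span g
span-back [] _ _ _ = refl
span-back {q = q} ((c , r) ∷ st) ((pos , _) , card , w) s keeps with ∧-true⁻ (keepsTop q c) keeps
... | k , ks = trans (span-liftCard card (State-back st w pos s) k) (cong suc (span-back st w s ks))

fixed⇒¬topFixed : ∀ {n b q g} .{{_ : NonZero n}} (st : Vec Step n) → IsWalk b q st q → State q g →
  back st g ≡ g → ¬ TopFixed (q , st)
fixed⇒¬topFixed {n} {g = g} st w s fixed keeps =
  <⇒≢ (m<n+m (span g) (>-nonZero⁻¹ n)) (trans (sym (cong span fixed)) (span-back st w s keeps))

-- The gaps g and g′ agree except possibly at the last u groups.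
data Agree (u : ℕ) : List ℕ → List ℕ → Set where
  any : ∀ {g g′} → length g ≤ u → Agree u g g′
  _∷_ : ∀ {g g′} d → Agree u g g′ → Agree u (d ∷ g) (d ∷ g′)

Agree-delay : ∀ {u g g′} k → Agree u g g′ → Agree u (delay k g) (delay k g′)
Agree-delay {g = []} k (any le) = any z≤n
Agree-delay {g = _ ∷ _} k (any le) = any le
Agree-delay k (d ∷ a) = (k + d) ∷ a

Agree-zero : ∀ {q g g′} → State q g → State q g′ → Agree 0 g g′ → g ≡ g′
Agree-zero [] [] _ = refl
Agree-zero (_ ∷ s) (_ ∷ s′) (d ∷ a) = cong (d ∷_) (Agree-zero s s′ a)

IsEmb-length : ∀ {xs ys bs} → IsEmb xs ys bs → length xs ≤ length ys
IsEmb-length [] = z≤n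
IsEmb-length (take _ e) = s≤s (IsEmb-length e)
IsEmb-length (skip e) = m≤n⇒m≤1+n (IsEmb-length e)

lastTrue-∷-false : ∀ b bs → lastTrue (b ∷ bs) ≡ false → lastTrue bs ≡ false
lastTrue-∷-false b [] _ = refl
lastTrue-∷-false b (_ ∷ _) eq = eq

IsEmb-length-pred : ∀ {xs ys bs} → IsEmb xs ys bs → lastTrue bs ≡ false → length xs ≤ pred (length ys)
IsEmb-length-pred [] _ = z≤n
-- Splitting `e` exposes a further entry of `ys`, so that `pred` and `lastTrue` compute.
IsEmb-length-pred (take _ e@(take _ _)) eq = s≤s (IsEmb-length-pred e eq)
IsEmb-length-pred (take _ e@(skip _)) eq = s≤s (IsEmb-length-pred e eq)
IsEmb-length-pred (skip e) eq = IsEmb-length e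

Agree-lift : ∀ {u xs ys bs g g′} → IsEmb xs ys bs → Pos xs → State ys g → State ys g′ →
  Agree u g g′ → Agree u (lift bs g) (lift bs g′)
Agree-lift {bs = bs} {g} e pos s s′ (any le) = any (begin
  length (lift bs g) ≡⟨ State-length (State-lift e pos s) ⟩
  _                  ≤⟨ IsEmb-length e ⟩
  _                  ≡⟨ State-length s ⟨
  length g           ≤⟨ le ⟩
  _                  ∎)
  where open ≤-Reasoning
Agree-lift (take _ e) (_ ∷ pos) (_ ∷ s) (_ ∷ s′) (d ∷ a) = d ∷ Agree-lift e pos s s′ a
Agree-lift (skip e) pos (_ ∷ s) (_ ∷ s′) (d ∷ a) = Agree-delay (suc d) (Agree-lift e pos s s′ a)

-- The last group is among the undetermined ones and has no preimage, so one undetermined group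
-- fewer remains before the card.
Agree-lift-drop : ∀ {u xs ys bs g g′} → IsEmb xs ys bs → Pos xs → State ys g → State ys g′ → lastTrue bs ≡ false →
  Agree (suc u) g g′ → Agree u (lift bs g) (lift bs g′)
Agree-lift-drop {u} {xs} {ys} {bs} {g} e pos s s′ eq (any le) = any (begin
  length (lift bs g) ≡⟨ State-length (State-lift e pos s) ⟩
  length xs          ≤⟨ IsEmb-length-pred e eq ⟩
  pred (length ys)   ≡⟨ cong pred (State-length s) ⟨
  pred (length g)    ≤⟨ pred-mono-≤ le ⟩
  u                  ∎)
  where open ≤-Reasoning
Agree-lift-drop {bs = b ∷ bs} (take _ e) (_ ∷ pos) (_ ∷ s) (_ ∷ s′) eq (d ∷ a) =
  d ∷ Agree-lift-drop e pos s s′ (lastTrue-∷-false b bs eq) a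
Agree-lift-drop {bs = b ∷ bs} (skip e) pos (_ ∷ s) (_ ∷ s′) eq (d ∷ a) =
  Agree-delay (suc d) (Agree-lift-drop e pos s s′ (lastTrue-∷-false b bs eq) a)

Agree-liftCard : ∀ {u q c r g g′} → IsCard q c r → Pos q → State r g → State r g′ →
  Agree u g g′ → Agree u (liftCard c g) (liftCard c g′)
Agree-liftCard wait pos s s′ a = Agree-delay 1 a
Agree-liftCard (throw e) (_ ∷ pos) s s′ a = 0 ∷ Agree-lift e pos s s′ a

Agree-liftCard-drop : ∀ {u q c r g g′} → IsCard q c r → Pos q → State r g → State r g′ → keepsTop q c ≡ false →
  Agree (suc u) g g′ → Agree u (liftCard c g) (liftCard c g′)
Agree-liftCard-drop wait pos [] [] _ _ = any z≤n
Agree-liftCard-drop (throw e) (_ ∷ pos) s s′ eq a = 0 ∷ Agree-lift-drop e pos s s′ eq a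

module _ {b : ℕ} where

  Agree-back : ∀ {n u q q′ g g′} (st : Vec Step n) → IsWalk b q st q′ → Pos q → State q′ g → State q′ g′ →
    Agree u g g′ → Agree u (back st g) (back st g′)
  Agree-back [] _ _ _ _ a = a
  Agree-back (_ ∷ st) ((pos′ , _) , card , w) pos s s′ a =
    Agree-liftCard card pos (State-back st w pos′ s) (State-back st w pos′ s′) (Agree-back st w pos′ s s′ a)

  -- A single card that loses the last group suffices, as the other cards of the round never
  -- increase `u`.
  Agree-back-drop : ∀ {n u q q′ g g′} (st : Vec Step n) → IsWalk b q st q′ → Pos q → State q′ g → State q′ g′ →
    keepsTopAlong q st ≢ true → Agree (suc u) g g′ → Agree u (back st g) (back st g′)
  Agree-back-drop [] _ _ _ _ ≢true _ = contradiction refl ≢true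
  Agree-back-drop {q = q} ((c , _) ∷ st) ((pos′ , _) , card , w) pos s s′ ≢true a with keepsTop q c in keeps
  ... | false = Agree-liftCard-drop card pos (State-back st w pos′ s) (State-back st w pos′ s′) keeps
                  (Agree-back st w pos′ s s′ a)
  ... | true = Agree-liftCard card pos (State-back st w pos′ s) (State-back st w pos′ s′)
                 (Agree-back-drop st w pos′ s s′ ≢true a)

iterate : {X : Set} → ℕ → (X → X) → X → X
iterate zero f x = x
iterate (suc k) f x = f (iterate k f x)

iterate-fixed : ∀ {X : Set} k (f : X → X) x → f x ≡ x → iterate k f x ≡ x
iterate-fixed zero f x fixed = refl
iterate-fixed (suc k) f x fixed = trans (cong f (iterate-fixed k f x fixed)) fixed

iterate-comm : ∀ {X : Set} k (f : X → X) x → f (iterate k f x) ≡ iterate k f (f x)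
iterate-comm zero f x = refl
iterate-comm (suc k) f x = cong f (iterate-comm k f x)

-- Every round settles at least one more group, so `length q` rounds settle all. The initial zeros
-- are arbitrary.
landingGaps : ∀ {n} → ClosedWalk n → List ℕ
landingGaps (q , st) = iterate (length q) (back st) (map (λ _ → 0) q)

module _ {n b q} (st : Vec Step n) (w : IsWalk b q st q) (pos : Pos q) (free : ¬ TopFixed (q , st)) where

  State-iterate : ∀ {g} k → State q g → State q (iterate k (back st) g)
  State-iterate zero s = s
  State-iterate (suc k) s = State-back st w pos (State-iterate k s)

  Agree-iterate : ∀ {g g′} k u → State q g → State q g′ → length q ≤ u + k →
    Agree u (iterate k (back st) g) (iterate k (back st) g′)
  Agree-iterate zero u s s′ le = any (subst₂ _≤_ (sym (State-length s)) (+-identityʳ u) le)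
  Agree-iterate (suc k) u s s′ le =
    Agree-back-drop st w pos (State-iterate k s) (State-iterate k s′) free
      (Agree-iterate k (suc u) s s′ (subst (length q ≤_) (+-suc u k) le))

  iterate-constant : ∀ {g g′} → State q g → State q g′ →
    iterate (length q) (back st) g ≡ iterate (length q) (back st) g′
  iterate-constant s s′ = Agree-zero (State-iterate (length q) s) (State-iterate (length q) s′)
    (Agree-iterate (length q) 0 s s′ ≤-refl)

  landingGaps-state : State q (landingGaps (q , st))
  landingGaps-state = State-iterate (length q) (State-zeros pos)

  -- One further round amounts to starting from `back st` of the zeros, and the result does not
  -- depend on the start.
  landingGaps-fixed : back st (landingGaps (q , st)) ≡ landingGaps (q , st)
  landingGaps-fixed = trans (iterate-comm (length q) (back st) _)
    (iterate-constant (State-back st w pos (State-zeros pos)) (State-zeros pos))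

  landingGaps-unique : ∀ {g} → State q g → back st g ≡ g → g ≡ landingGaps (q , st)
  landingGaps-unique s fixed = trans (sym (iterate-fixed (length q) (back st) _ fixed))
    (iterate-constant s (State-zeros pos))

-- The bijection between free closed walks and siteswaps

siteswap : ∀ {n} → ClosedWalk n → Vec (List ℕ) n
siteswap (q , st) = throwsAlong q st (landingGaps (q , st))

siteswap-chain : ∀ {n b} (w : ClosedWalk n) → IsClosed b w → ¬ TopFixed w →
  Chain (ev (proj₁ w) (landingGaps w)) (siteswap w) (ev (proj₁ w) (landingGaps w))
siteswap-chain (q , st) (comp , w) free =
  subst (λ g → Chain (ev q g) (siteswap (q , st)) (ev q (landingGaps (q , st))))
    (landingGaps-fixed st w (proj₁ comp) free)
    (walk⇒chain st w comp (landingGaps-state st w (proj₁ comp) free))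

siteswap-sound : ∀ {n b} .{{_ : NonZero n}} (w : ClosedWalk n) → IsClosed b w → ¬ TopFixed w →
  IsMultiplexSiteswap n b (siteswap w)
siteswap-sound (q , st) closed@((pos , sum≡) , w) free =
  chain⇒siteswap (siteswap (q , st)) (ev-below q (landingGaps (q , st)))
    (trans (Σ<-ev-span (landingGaps-state st w pos free)) sum≡) (siteswap-chain (q , st) closed free)

-- The encoded state of the pattern at time 0 gives both the start of the walk and gaps fixed by its
-- transport. Having a fixed point makes the walk free, and uniqueness identifies these gaps with
-- `landingGaps`.
siteswap-complete : ∀ {n b} .{{_ : NonZero n}} (T : Vec (List ℕ) n) → IsMultiplexSiteswap n b T →
  ∃ λ w → IsClosed b w × ¬ TopFixed w × T ≡ siteswap w
siteswap-complete T isSiteswap with siteswap⇒chain T isSiteswap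
... | N , f , lows , below , Σ≡b , c with encode N f below
... | q , g , s , ev≡ , sum≡
  with chain⇒walk T lows s s (λ i N≤i → trans (ev≡ i) (below i N≤i)) (trans sum≡ Σ≡b)
         (Chain-congˡ T (λ i → sym (ev≡ i)) (Chain-congʳ T (λ i → sym (ev≡ i)) c))
... | st , w , fixed , T≡ = (q , st) , ((State-pos s , trans sum≡ Σ≡b) , w) , free ,
  trans (sym T≡) (cong (throwsAlong q st) (landingGaps-unique st w (State-pos s) free s fixed))
  where free = fixed⇒¬topFixed st w s fixed

-- The pattern alone determines its state at time 0 by `closed-unique`; groups, gaps and cards
-- follow from that.
siteswap-injective : ∀ {n b} .{{_ : NonZero n}} (w w′ : ClosedWalk n) → IsClosed b w → IsClosed b w′ →
  ¬ TopFixed w → ¬ TopFixed w′ → siteswap w ≡ siteswap w′ → w ≡ w′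
siteswap-injective (q , st) (q′ , st′) closed@(comp , w) closed′@(comp′ , w′) free free′ eq
  with ev-injective (landingGaps-state st w (proj₁ comp) free) (landingGaps-state st′ w′ (proj₁ comp′) free′) states≡
  where
  g = landingGaps (q , st)
  g′ = landingGaps (q′ , st′)
  states≡ : ∀ i → ev q g i ≡ ev q′ g′ i
  states≡ = closed-unique {N = span g + span g′} (siteswap (q , st))
    (Below-mono (m≤m+n (span g) (span g′)) (ev-below q g))
    (Below-mono (m≤n+m (span g′) (span g)) (ev-below q′ g′))
    (siteswap-chain (q , st) closed free)
    (subst (λ T → Chain (ev q′ g′) T (ev q′ g′)) (sym eq) (siteswap-chain (q′ , st′) closed′ free′))
... | refl , gaps≡ = cong (q ,_) (walk-unique st st′ w w′ comp (landingGaps-state st w (proj₁ comp) free)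
  (trans (landingGaps-fixed st w (proj₁ comp) free) (trans gaps≡ (trans (sym (landingGaps-fixed st′ w′ (proj₁ comp) free′))
    (cong (back st′) (sym gaps≡)))))
  (trans eq (cong (throwsAlong q st′) (sym gaps≡))))

freeWalks : ∀ b n → List (ClosedWalk n)
freeWalks b n = filter (¬? ∘ topFixed?) (closedWalks b n)

∈-freeWalks⁻ : ∀ b n {w} → w ∈ freeWalks b n → IsClosed b w × ¬ TopFixed w
∈-freeWalks⁻ b n w∈ with ∈-filter⁻ (¬? ∘ topFixed?) {xs = closedWalks b n} w∈
... | w∈′ , free = ∈-closedWalks⁻ b n w∈′ , free

open import Data.Integer using (+_)

length-freeWalks : ∀ b n .{{_ : NonZero n}} → + length (freeWalks b n) ≡ ssFormula b n
length-freeWalks b n = sym (begin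
  + trace (A b ^ᴹ n) ℤ.- + tops
    ≡⟨ cong (λ a → + a ℤ.- + tops) (trace≡length-closedWalks b n) ⟩
  + length (closedWalks b n) ℤ.- + tops
    ≡⟨ cong (λ a → + a ℤ.- + tops) (length-filter-split topFixed? (closedWalks b n)) ⟨
  + (length (filter topFixed? (closedWalks b n)) + frees) ℤ.- + tops
    ≡⟨ cong (λ a → + (a + frees) ℤ.- + tops) (length-topFixed b n) ⟩
  + (tops + frees) ℤ.- + tops
    ≡⟨ ℤ.m-n≡m⊖n (tops + frees) tops ⟩
  (tops + frees) ℤ.⊖ tops
    ≡⟨ ℤ.⊖-≥ (m≤m+n tops frees) ⟩
  + (tops + frees ∸ tops)
    ≡⟨ cong +_ (m+n∸m≡n tops frees) ⟩
  + frees ∎)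
  where
  open ≡-Reasoning
  tops = sum (map (λ i → trace (A i ^ᴹ n)) (upTo b))
  frees = length (freeWalks b n)

theorem7 : (b n : ℕ) → .{{_ : NonZero n}} →
    Σ (List (Vec (List ℕ) n)) (λ L →
    Unique L
    × (∀ T → (T ∈ L) ⇔ IsMultiplexSiteswap n b T)
    × (+ length L ≡ ssFormula b n))
theorem7 b n = map siteswap (freeWalks b n) , unique , (λ T → mk⇔ (sound T) (complete T)) ,
  trans (cong +_ (List.length-map siteswap (freeWalks b n))) (length-freeWalks b n)
  where
  unique : Unique (map siteswap (freeWalks b n))
  unique = map-unique siteswap
    (λ {w} {w′} w∈ w′∈ →
      let closed , free = ∈-freeWalks⁻ b n w∈
          closed′ , free′ = ∈-freeWalks⁻ b n w′∈
      in siteswap-injective w w′ closed closed′ free free′)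
    (Unique.filter⁺ (¬? ∘ topFixed?) (closedWalks-unique b n))
  sound : ∀ T → T ∈ map siteswap (freeWalks b n) → IsMultiplexSiteswap n b T
  sound T T∈ with ∈-map⁻ siteswap T∈
  ... | w , w∈ , refl = let closed , free = ∈-freeWalks⁻ b n w∈ in siteswap-sound w closed free
  complete : ∀ T → IsMultiplexSiteswap n b T → T ∈ map siteswap (freeWalks b n)
  complete T isSiteswap with siteswap-complete T isSiteswap
  ... | w , closed , free , refl =
    ∈-map⁺ siteswap (∈-filter⁺ (¬? ∘ topFixed?) (∈-closedWalks⁺ b n closed) free)
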